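{- For every integer $n>1$, $$\sum_{p\in T_{n,n-1}}q^{\operatorname{minimal}(p)}=q^{\binom n2}\,C_{n-1}(q^{ -1}),$$ where $C_m(q)$ is the Carlitz–Riordan $q$-Catalan number.
   Context: $\overrightarrow{K}_n$ is the transitive tournament with vertices $v_1,\dots,v_n$ and directed edges $(v_i,v_j)$, $i<j$. $T_{n,n-1}$ is the set of maximal transitive partitions of $\overrightarrow{K}_n$: unordered partitions of the edge set into $n-1$ nonempty blocks such that every cycle of the underlying undirected graph contains two edges in the same block with opposite orientations with respect to a traversal of the cycle. An edge $(v_i,v_j)$, $i<j$, is minimal in $p$ if every edge $(v_a,v_b)$, $a<b$, in the block of $p$ containing $(v_i,v_j)$ satisfies $i\le a$. $\operatorname{minimal}(p)$ is the number of minimal edges in $p$. The $q$-Catalan numbers are defined by $C_0(q):=1$ and $C_{m+1}(q):=\sum_{k=0}^{m}q^{(k+1)(m-k)}C_k(q)C_{m-k}(q)$ for $m\ge 0$. -}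

module Defs where

open import Algebra.Bundles using (CommutativeRing)
import Algebra.Properties.Semiring.Exp as Exp
import Algebra.Properties.Semiring.Sum as Sum
open import Data.Fin.Base as Fin using (Fin; zero; suc; toℕ)
import Data.Fin.Properties as Fin
open import Data.List.Base as List
  using (List; []; _∷_; _++_; _∷ʳ_; map; zip; length; filter; deduplicate;
         concatMap; upTo; allFin; cartesianProductWith; foldr)
open import Data.List.Membership.Propositional using (_∈_; find; lose)
open import Data.List.Membership.Propositional.Properties
  using (∈-map⁺; ∈-map⁻; ∈-++⁺ˡ; ∈-++⁺ʳ; ∈-allFin; ∈-filter⁺; ∈-filter⁻; ∈-upTo⁺;
         ∈-concatMap⁺; ∈-cartesianProductWith⁺; ∈-deduplicate⁻; ∈-lookup)
open import Data.List.Relation.Unary.All as All using (All; []; _∷_)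
open import Data.List.Relation.Unary.AllPairs using (AllPairs; []; _∷_)
open import Data.List.Relation.Unary.Any as Any using (Any; here; there)
import Data.List.Relation.Unary.Any.Properties as Any
open import Data.List.Relation.Unary.Unique.Propositional using (Unique)
import Data.List.Relation.Unary.Unique.Propositional.Properties as Unique
import Data.List.Relation.Unary.Unique.DecPropositional as DecUnique
import Data.List.Relation.Unary.Unique.DecSetoid.Properties as DecSetoidUnique
open import Data.Nat.Base using (ℕ; zero; suc; _≤_; _<_; _∸_; z≤n; s≤s)
open import Data.Nat.Base as ℕ using ()
open import Data.Nat.Induction using (Acc; acc; <-wellFounded)
import Data.Nat.Properties as ℕ
open import Data.Product.Base using (∃; ∃₂; _×_; _,_; proj₁; proj₂; uncurry)
open import Data.Product.Properties using (≡-dec)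
open import Data.Vec.Base as Vec using (Vec; []; _∷_)
import Data.Vec.Properties as Vec
open import Function.Base using (_∘_)
open import Function.Bundles using (_⇔_; mk⇔; Equivalence)
open import Function.Construct.Composition using (_⇔-∘_)
open import Function.Construct.Identity using (⇔-id)
open import Function.Construct.Symmetry using (⇔-sym)
open import Function.Definitions using (StrictlySurjective)
open import Relation.Binary.Bundles using (DecSetoid)
open import Relation.Binary.Definitions using (Decidable; DecidableEquality)
open import Relation.Binary.PropositionalEquality
  using (_≡_; refl; sym; trans; cong; subst)
open import Relation.Nullary.Decidable using (Dec; map′; _×-dec_; _→-dec_)
open import Relation.Nullary.Negation using (¬_; contradiction)
import Relation.Unary as U

-- The vertex v_{i+1} is  i : Fin n.
record Edge (n : ℕ) : Set where
  constructor edge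
  field
    src     : Fin n
    tgt     : Fin n
    src<tgt : src Fin.< tgt

open Edge public

edge-≡ : ∀ {n} {e f : Edge n} → src e ≡ src f → tgt e ≡ tgt f → e ≡ f
edge-≡ {e = edge i j p} {edge .i .j q} refl refl =
  cong (edge i j) (Fin.<-irrelevant p q)

infix 4 _≟ᴱ_

_≟ᴱ_ : ∀ {n} → DecidableEquality (Edge n)
e ≟ᴱ f = map′ (uncurry edge-≡) (λ { refl → refl , refl })
              ((src e Fin.≟ src f) ×-dec (tgt e Fin.≟ tgt f))

shift : ∀ {n} → Edge n → Edge (suc n)
shift (edge i j i<j) = edge (suc i) (suc j) (s≤s i<j)

fromZero : ∀ {n} → Fin n → Edge (suc n)
fromZero j = edge zero (suc j) (s≤s z≤n)

edges : ∀ n → List (Edge n)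
edges zero    = []
edges (suc n) = map fromZero (allFin n) ++ map shift (edges n)

∈-edges : ∀ {n} (e : Edge n) → e ∈ edges n
∈-edges {suc n} (edge zero (suc j) (s≤s z≤n)) =
  ∈-++⁺ˡ (∈-map⁺ fromZero (∈-allFin j))
∈-edges {suc n} (edge (suc i) (suc j) (s≤s i<j)) =
  ∈-++⁺ʳ (map fromZero (allFin n)) (∈-map⁺ shift (∈-edges (edge i j i<j)))

edges-unique : ∀ n → Unique (edges n)
edges-unique zero    = []
edges-unique (suc n) = Unique.++⁺
  (Unique.map⁺ (Fin.suc-injective ∘ cong tgt) (Unique.allFin⁺ n))
  (Unique.map⁺ shift-injective (edges-unique n))
  disjoint
  where
  shift-injective : ∀ {e f : Edge n} → shift e ≡ shift f → e ≡ f
  shift-injective eq = edge-≡ (Fin.suc-injective (cong src eq))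
                              (Fin.suc-injective (cong tgt eq))

  disjoint : ∀ {e} → ¬ (e ∈ map fromZero (allFin n) × e ∈ map shift (edges n))
  disjoint (e∈₀ , e∈ₛ) with ∈-map⁻ fromZero e∈₀ | ∈-map⁻ shift e∈ₛ
  ... | _ , _ , refl | _ , _ , ()

∃ᴱ? : ∀ {n p} {P : U.Pred (Edge n) p} → U.Decidable P → Dec (∃ P)
∃ᴱ? P? = map′ (λ a → let e , _ , pe = find a in e , pe)
              (λ { (e , pe) → lose (∈-edges e) pe })
              (Any.any? P? (edges _))

∀ᴱ? : ∀ {n p} {P : U.Pred (Edge n) p} → U.Decidable P → Dec (∀ e → P e)
∀ᴱ? P? = map′ (λ a e → All.lookup a (∈-edges e)) (λ p → All.tabulate (λ _ → p _))
              (All.all? P? (edges _))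

-- The underlying graph is complete, so a cycle, with a starting point and a
-- direction of traversal, is a list of at least three distinct vertices.
IsCycle : ∀ {n} → List (Fin n) → Set
IsCycle c = Unique c × 3 ≤ length c

-- The ordered pairs of consecutive vertices met in the traversal, including
-- the closing step from the last vertex back to the first.
steps : ∀ {n} → List (Fin n) → List (Fin n × Fin n)
steps []         = []
steps c@(v ∷ vs) = zip c (vs ∷ʳ v)

-- A labelling with k labels, all of them used, presents the partition of the
-- edges into k nonempty blocks whose blocks are the fibres.
Labelling : ℕ → ℕ → Set
Labelling n k = Edge n → Fin k

SameBlock : ∀ {n k} → Labelling n k → Edge n → Edge n → Set
SameBlock p e f = p e ≡ p f

-- p and p′ present the same unordered partition.
infix 4 _∼_

_∼_ : ∀ {n k} → Labelling n k → Labelling n k → Set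
p ∼ p′ = ∀ e f → SameBlock p e f ⇔ SameBlock p′ e f

-- The edge e is traversed along its orientation and f against it.
IsTransitive : ∀ {n k} → Labelling n k → Set
IsTransitive {n} p = ∀ (c : List (Fin n)) → IsCycle c →
  ∃₂ λ e f → (src e , tgt e) ∈ steps c × (tgt f , src f) ∈ steps c × SameBlock p e f

IsTransitivePartition : ∀ {n k} → Labelling n k → Set
IsTransitivePartition p = StrictlySurjective _≡_ p × IsTransitive p

vectors : ∀ {A : Set} → List A → ∀ m → List (Vec A m)
vectors xs zero    = [] ∷ []
vectors xs (suc m) = cartesianProductWith _∷_ xs (vectors xs m)

∈-vectors : ∀ {A : Set} {xs : List A} → (∀ x → x ∈ xs) →
            ∀ {m} (v : Vec A m) → v ∈ vectors xs m
∈-vectors all []      = here refl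
∈-vectors all (x ∷ v) = ∈-cartesianProductWith⁺ _∷_ (all x) (∈-vectors all v)

lookup-injective : ∀ {A : Set} {xs : List A} → Unique xs → ∀ {i j} →
                   List.lookup xs i ≡ List.lookup xs j → i ≡ j
lookup-injective (_  ∷ _)  {zero}  {zero}  _  = refl
lookup-injective (x∉ ∷ _)  {zero}  {suc j} eq = contradiction eq (All.lookup x∉ (∈-lookup j))
lookup-injective (x∉ ∷ _)  {suc i} {zero}  eq = contradiction (sym eq) (All.lookup x∉ (∈-lookup i))
lookup-injective (_  ∷ xs) {suc i} {suc j} eq = cong suc (lookup-injective xs eq)

length≤n : ∀ {n} {c : List (Fin n)} → Unique c → length c ≤ n
length≤n u = Fin.injective⇒≤ (lookup-injective u)

shortLists : ∀ n → List (List (Fin n))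
shortLists n = concatMap (λ m → map Vec.toList (vectors (allFin n) m)) (upTo (suc n))

∈-shortLists : ∀ {n} {c : List (Fin n)} → Unique c → c ∈ shortLists n
∈-shortLists {n} {c} u =
  ∈-concatMap⁺ (λ m → map Vec.toList (vectors (allFin n) m))
    (lose (∈-upTo⁺ (s≤s (length≤n u)))
      (subst (_∈ map Vec.toList (vectors (allFin n) (length c)))
             (Vec.toList∘fromList c)
             (∈-map⁺ Vec.toList (∈-vectors ∈-allFin (Vec.fromList c)))))

isCycle? : ∀ {n} → U.Decidable (IsCycle {n})
isCycle? c = DecUnique.unique? Fin._≟_ c ×-dec (3 ℕ.≤? length c)

_∼?_ : ∀ {n k} → Decidable (_∼_ {n} {k})
p ∼? p′ = ∀ᴱ? λ e → ∀ᴱ? λ f →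
  map′ (uncurry mk⇔) (λ h → Equivalence.to h , Equivalence.from h)
    (((p e Fin.≟ p f) →-dec (p′ e Fin.≟ p′ f)) ×-dec
     ((p′ e Fin.≟ p′ f) →-dec (p e Fin.≟ p f)))

isTransitive? : ∀ {n k} → U.Decidable (IsTransitive {n} {k})
isTransitive? {n} p =
  map′ (λ a c cyc → All.lookup a (∈-shortLists (proj₁ cyc)) cyc)
       (λ h → All.tabulate (λ _ → h _))
       (All.all? (λ c → isCycle? c →-dec
          ∃ᴱ? λ e → ∃ᴱ? λ f →
            ((src e , tgt e) ∈? steps c) ×-dec
            ((tgt f , src f) ∈? steps c) ×-dec
            (p e Fin.≟ p f))
         (shortLists n))
  where open import Data.List.Membership.DecPropositional
               (≡-dec (Fin._≟_ {n}) (λ {_} → Fin._≟_ {n})) using (_∈?_)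

isTransitivePartition? : ∀ {n k} → U.Decidable (IsTransitivePartition {n} {k})
isTransitivePartition? p =
  Fin.all? (λ b → ∃ᴱ? λ e → p e Fin.≟ b) ×-dec isTransitive? p

∼-decSetoid : ℕ → ℕ → DecSetoid _ _
∼-decSetoid n k = record
  { Carrier          = Labelling n k
  ; _≈_              = _∼_
  ; isDecEquivalence = record
    { isEquivalence = record
      { refl  = λ e f → ⇔-id _
      ; sym   = λ p∼p′ e f → ⇔-sym (p∼p′ e f)
      ; trans = λ p∼p′ p′∼p″ e f → p′∼p″ e f ⇔-∘ p∼p′ e f
      }
    ; _≟_ = _∼?_
    }
  }

fromTable : ∀ {n k} → Vec (Fin k) (length (edges n)) → Labelling n k
fromTable v e = Vec.lookup v (Any.index (∈-edges e))

labellings : ∀ n k → List (Labelling n k)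
labellings n k = map fromTable (vectors (allFin k) (length (edges n)))

labellings-complete : ∀ {n k} (p : Labelling n k) →
                      ∃ λ p′ → p′ ∈ labellings n k × (∀ e → p′ e ≡ p e)
labellings-complete {n} p = fromTable table
                          , ∈-map⁺ fromTable (∈-vectors ∈-allFin table)
                          , λ e → trans (Vec.lookup∘tabulate _ (Any.index (∈-edges e)))
                                        (cong p (sym (Any.lookup-index (∈-edges e))))
  where table = Vec.tabulate (p ∘ List.lookup (edges n))

-- T_{n,k}: transitive partitions of the edges of K_n into k blocks, with exactly
-- one labelling per unordered partition (T-sound, T-unique, T-complete).
T : ∀ n k → List (Labelling n k)
T n k = deduplicate _∼?_ (filter isTransitivePartition? (labellings n k))

T-sound : ∀ {n k p} → p ∈ T n k → IsTransitivePartition p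
T-sound {n} {k} p∈T = proj₂ (∈-filter⁻ isTransitivePartition? {xs = labellings n k}
  (∈-deduplicate⁻ _∼?_ (filter isTransitivePartition? (labellings n k)) p∈T))

T-unique : ∀ n k → AllPairs (λ p p′ → ¬ p ∼ p′) (T n k)
T-unique n k = DecSetoidUnique.deduplicate-! (∼-decSetoid n k) _

T-complete : ∀ {n k} (p : Labelling n k) → IsTransitivePartition p →
             Any (p ∼_) (T n k)
T-complete {n} {k} p (p-surj , p-trans) with labellings-complete p
... | p′ , p′∈ , p′≗p =
  Any.deduplicate⁺ _∼?_ (λ q∼r p∼r → S.trans p∼r (S.sym q∼r))
    (lose (∈-filter⁺ isTransitivePartition? p′∈ (p′-surj , p′-trans)) p∼p′)
  where
  module S = DecSetoid (∼-decSetoid n k)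

  p∼p′ : p ∼ p′
  p∼p′ e f = mk⇔ (λ eq → trans (p′≗p e) (trans eq (sym (p′≗p f))))
                 (λ eq → trans (sym (p′≗p e)) (trans eq (p′≗p f)))

  p′-surj : StrictlySurjective _≡_ p′
  p′-surj b = let e , eq = p-surj b in e , trans (p′≗p e) eq

  p′-trans : IsTransitive p′
  p′-trans c cyc = let e , f , e∈ , f∈ , eq = p-trans c cyc in
    e , f , e∈ , f∈ , Equivalence.to (p∼p′ e f) eq

IsMinimal : ∀ {n k} → Labelling n k → Edge n → Set
IsMinimal p e = ∀ f → SameBlock p f e → src e Fin.≤ src f

isMinimal? : ∀ {n k} (p : Labelling n k) → U.Decidable (IsMinimal p)
isMinimal? p e = ∀ᴱ? λ f → (p f Fin.≟ p e) →-dec (src e Fin.≤? src f)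

minimal : ∀ {n k} → Labelling n k → ℕ
minimal p = length (filter (isMinimal? p) (edges _))

-- An identity of Laurent polynomials in q is expressed as an identity at every
-- unit q of every commutative ring R; ℤ[q,q⁻¹] is the universal instance.
module _ {c ℓ} (R : CommutativeRing c ℓ) where

  open CommutativeRing R hiding (refl; sym; trans)
  open Exp semiring using (_^_)
  open Sum semiring using (sum-syntax; sum-cong-≋)
  private module R = CommutativeRing R

  sumOver : ∀ {a} {A : Set a} → List A → (A → Carrier) → Carrier
  sumOver xs f = foldr _+_ 0# (map f xs)

  qCatalanAcc : Carrier → ∀ m → Acc _<_ m → Carrier
  qCatalanAcc q zero    _        = 1#
  qCatalanAcc q (suc m) (acc rs) = ∑[ k < suc m ]
    (q ^ (suc (toℕ k) ℕ.* (m ∸ toℕ k))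
      * qCatalanAcc q (toℕ k) (rs (Fin.toℕ<n k))
      * qCatalanAcc q (m ∸ toℕ k) (rs (s≤s (ℕ.m∸n≤m m (toℕ k)))))

  -- The value at q of C_m; the recurrence is qCatalan-suc.
  qCatalan : Carrier → ℕ → Carrier
  qCatalan q m = qCatalanAcc q m (<-wellFounded m)

  private
    summand : ∀ q m (f g : Fin (suc m) → Carrier) → Fin (suc m) → Carrier
    summand q m f g k = q ^ (suc (toℕ k) ℕ.* (m ∸ toℕ k)) * f k * g k

    summand-cong : ∀ q m {f f′ g g′ : Fin (suc m) → Carrier} →
                   (∀ k → f k ≈ f′ k) → (∀ k → g k ≈ g′ k) →
                   ∑[ k < suc m ] summand q m f g k ≈ ∑[ k < suc m ] summand q m f′ g′ k
    summand-cong q m {f} {f′} {g} {g′} f≈f′ g≈g′ =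
      sum-cong-≋ {suc m} {summand q m f g} {summand q m f′ g′}
        (λ k → *-cong (*-congˡ (f≈f′ k)) (g≈g′ k))

  qCatalanAcc-irrelevant : ∀ q m (a b : Acc _<_ m) →
                           qCatalanAcc q m a ≈ qCatalanAcc q m b
  qCatalanAcc-irrelevant q zero    _        _        = R.refl
  qCatalanAcc-irrelevant q (suc m) (acc rs) (acc ss) = summand-cong q m
    {λ k → qCatalanAcc q (toℕ k) (rs (Fin.toℕ<n k))}
    {λ k → qCatalanAcc q (toℕ k) (ss (Fin.toℕ<n k))}
    {λ k → qCatalanAcc q (m ∸ toℕ k) (rs (s≤s (ℕ.m∸n≤m m (toℕ k))))}
    {λ k → qCatalanAcc q (m ∸ toℕ k) (ss (s≤s (ℕ.m∸n≤m m (toℕ k))))}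
    (λ k → qCatalanAcc-irrelevant q (toℕ k) _ _)
    (λ k → qCatalanAcc-irrelevant q (m ∸ toℕ k) _ _)

  qCatalan-suc : ∀ q m → qCatalan q (suc m) ≈ ∑[ k < suc m ]
    (q ^ (suc (toℕ k) ℕ.* (m ∸ toℕ k)) * qCatalan q (toℕ k) * qCatalan q (m ∸ toℕ k))
  qCatalan-suc q m = unfold (<-wellFounded (suc m))
    where
    unfold : (a : Acc _<_ (suc m)) → qCatalanAcc q (suc m) a ≈
             ∑[ k < suc m ] summand q m (qCatalan q ∘ toℕ) (λ k → qCatalan q (m ∸ toℕ k)) k
    unfold (acc rs) = summand-cong q m
      {λ k → qCatalanAcc q (toℕ k) (rs (Fin.toℕ<n k))}
      {qCatalan q ∘ toℕ}
      {λ k → qCatalanAcc q (m ∸ toℕ k) (rs (s≤s (ℕ.m∸n≤m m (toℕ k))))}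
      {λ k → qCatalan q (m ∸ toℕ k)}
      (λ k → qCatalanAcc-irrelevant q (toℕ k)
               (rs (Fin.toℕ<n k)) (<-wellFounded (toℕ k)))
      (λ k → qCatalanAcc-irrelevant q (m ∸ toℕ k)
               (rs (s≤s (ℕ.m∸n≤m m (toℕ k)))) (<-wellFounded (m ∸ toℕ k)))

{-# OPTIONS --safe #-}
module Submission where

open import Defs
open import Algebra.Bundles using (CommutativeRing)
open import Algebra.Properties.Semiring.Exp using ()
open import Data.Nat.Base using (ℕ; _>_; _∸_)
open import Data.Nat.Combinatorics using (_C_)

import Algebra.Properties.CommutativeSemiring.Exp as Exp
import Algebra.Properties.Semiring.Sum as Sum
import Algebra.Solver.CommutativeMonoid as CommutativeMonoidSolver
open import Data.Bool.Base using (if_then_else_; true; false)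
open import Data.Fin.Base as Fin using (Fin; zero; suc; toℕ; fromℕ<; inject₁)
import Data.Fin.Properties as Fin
open import Data.List.Base
  using (List; []; _∷_; _++_; _∷ʳ_; zip; map; length; filter; tabulate; allFin;
         concat; cartesianProductWith)
import Data.List.Properties as List
open import Data.List.Membership.Propositional using (_∈_; find)
open import Data.List.Membership.Propositional.Properties
  using (∈-++⁻; ∈-∃++; ∈-concat⁺′; ∈-concat⁻′; ∈-cartesianProductWith⁺;
         ∈-cartesianProductWith⁻; ∈-tabulate⁺; ∈-tabulate⁻)
open import Data.List.Relation.Binary.Permutation.Propositional
  using (_↭_; ↭⇒↭ₛ; ↭-sym; ↭-trans; ↭-refl; ↭-prep)
import Data.List.Relation.Binary.Permutation.Propositional.Properties as Perm
import Data.List.Relation.Binary.Permutation.Setoid.Properties as PermSetoid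
open import Data.List.Relation.Binary.Pointwise using (Pointwise; []; _∷_)
open import Data.List.Relation.Unary.All as All using (All; []; _∷_)
import Data.List.Relation.Unary.All.Properties as All
open import Data.List.Relation.Unary.AllPairs as AllPairs using (AllPairs; []; _∷_)
import Data.List.Relation.Unary.AllPairs.Properties as AllPairs
open import Data.List.Relation.Unary.Any as Any using (Any; here; there)
open import Data.List.Relation.Unary.Unique.Propositional using (Unique)
import Data.List.Relation.Unary.Unique.Propositional.Properties as Unique
open import Data.Nat.Base as ℕ using (zero; suc; _+_; _≤_; _<_; z≤n; s≤s; s≤s⁻¹; _≡ᵇ_)
open import Data.Nat.Combinatorics using (nC1≡n; nCk+nC[k+1]≡[n+1]C[k+1])
open import Data.Nat.ListAction using (sum)
import Data.Nat.ListAction.Properties as ℕ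
import Data.Nat.Properties as ℕ
open import Data.Nat.Tactic.RingSolver using (solve-∀)
open import Data.Product.Base using (∃; ∃₂; _×_; _,_; proj₁; proj₂)
open import Data.Sum.Base as Sum⊎ using (_⊎_; inj₁; inj₂; swap)
open import Function.Base using (_∘_; id)
open import Function.Bundles using (_⇔_; mk⇔; Equivalence)
open import Function.Definitions using (Injective)
open import Relation.Binary.Definitions using (tri<; tri≈; tri>)
open import Relation.Binary.PropositionalEquality
open import Relation.Nullary.Decidable using (yes; no)
open import Relation.Nullary.Negation using (¬_; contradiction)
import Relation.Unary as U

-- In a transitive partition the triangle v_i , v_k , v_j (i < k < j) puts the edge
-- (v_i , v_j) in the block of (v_i , v_k) or of (v_k , v_j).  Hence each block contains
-- an edge (v_k , v_{k+1}), and if there are n - 1 blocks each contains exactly one.  Let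
-- g(i , j) be the k for which (v_k , v_{k+1}) lies in the block of (v_i , v_j).  With
-- s = g(1 , n) the triangle condition forces g(i , j) = s whenever i ≤ s < j, and
-- recursively g is the lowest-common-ancestor function of a binary tree with leaves
-- v_1 , … , v_n.  Conversely every binary tree gives a transitive partition, because a
-- closed walk that crosses from the left to the right subtree of a node also crosses back.
-- A node with r leaves in its right subtree contributes r minimal edges, so the sum
-- satisfies the same recurrence as q^(n C 2) C_{n-1}(q⁻¹).

-- Binary trees and their lowest common ancestors

data Tree : Set where
  leaf : Tree
  node : Tree → Tree → Tree

size : Tree → ℕ
size leaf       = 0
size (node l r) = suc (size l + size r)

-- Location of a pair of leaves under a root whose left subtree has the leaves 0 to `s`. `left`
-- bounds only `j`, since the pairs of interest have i < j; `right` is indexed by sums so that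
-- matching exposes the coordinates inside the right subtree.
data Position (s : ℕ) : ℕ → ℕ → Set where
  left  : ∀ {i j} → j ≤ s → Position s i j
  cross : ∀ {i j} → i ≤ s → s < j → Position s i j
  right : ∀ i j → Position s (suc s + i) (suc s + j)

position : ∀ s i j → Position s i j
position s i j with j ℕ.≤? s
... | yes j≤s = left j≤s
... | no  j≰s with i ℕ.≤? s
...   | yes i≤s = cross i≤s (ℕ.≰⇒> j≰s)
...   | no  i≰s = subst₂ (Position s) (ℕ.m+[n∸m]≡n (ℕ.≰⇒> i≰s)) (ℕ.m+[n∸m]≡n (ℕ.≰⇒> j≰s))
                         (right (i ∸ suc s) (j ∸ suc s))

-- The leaves 0 , … , size t and the internal nodes 0 , … , size t ∸ 1 of t are
-- both numbered from left to right; for i < j, meet t i j is the lowest node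
-- above the leaves i and j.
meet : Tree → ℕ → ℕ → ℕ
meet leaf       i j = 0
meet (node l r) i j with position (size l) i j
... | left _      = meet l i j
... | cross _ _   = size l
... | right i′ j′ = suc (size l) + meet r i′ j′

meet-left : ∀ l r {i j} → j ≤ size l → meet (node l r) i j ≡ meet l i j
meet-left l r {i} {j} j≤s with position (size l) i j
... | left _      = refl
... | cross _ s<j = contradiction j≤s (ℕ.<⇒≱ s<j)
... | right _ j′  = contradiction j≤s (ℕ.<⇒≱ (s≤s (ℕ.m≤m+n _ j′)))

meet-cross : ∀ l r {i j} → i ≤ size l → size l < j → meet (node l r) i j ≡ size l
meet-cross l r {i} {j} i≤s s<j with position (size l) i j
... | left j≤s   = contradiction j≤s (ℕ.<⇒≱ s<j)
... | cross _ _  = refl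
... | right i′ _ = contradiction i≤s (ℕ.<⇒≱ (s≤s (ℕ.m≤m+n _ i′)))

-- Phrased with subtraction for `opposite-steps`, where the leaves are values of a function and are
-- not given as sums.
meet-right-∸ : ∀ l r {i j} → size l < i → size l < j →
               meet (node l r) i j ≡ suc (size l) + meet r (i ∸ suc (size l)) (j ∸ suc (size l))
meet-right-∸ l r {i} {j} s<i s<j with position (size l) i j
... | left j≤s    = contradiction j≤s (ℕ.<⇒≱ s<j)
... | cross i≤s _ = contradiction i≤s (ℕ.<⇒≱ s<i)
... | right i′ j′ = cong (suc (size l) +_)
  (sym (cong₂ (meet r) (ℕ.m+n∸m≡n (size l) i′) (ℕ.m+n∸m≡n (size l) j′)))

meet-right : ∀ l r i j → meet (node l r) (suc (size l) + i) (suc (size l) + j) ≡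
                         suc (size l) + meet r i j
meet-right l r i j = trans (meet-right-∸ l r (s≤s (ℕ.m≤m+n _ i)) (s≤s (ℕ.m≤m+n _ j)))
  (cong (suc (size l) +_) (cong₂ (meet r) (ℕ.m+n∸m≡n (size l) i) (ℕ.m+n∸m≡n (size l) j)))

right-≤ : ∀ s {r j} → suc s + j ≤ suc (s + r) → j ≤ r
right-≤ s = ℕ.+-cancelˡ-≤ s _ _ ∘ s≤s⁻¹

-- From left to right, node k stands between the leaves k and k + 1, and the lowest node above two
-- leaves separates them.
meet-bounds : ∀ t {i j} → i < j → j ≤ size t → i ≤ meet t i j × meet t i j < j
meet-bounds leaf       i<j z≤n = contradiction i<j ℕ.n≮0
meet-bounds (node l r) {i} {j} i<j j≤ with position (size l) i j
... | left j≤s      = meet-bounds l i<j j≤s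
... | cross i≤s s<j = i≤s , s<j
... | right i′ j′   =
  let lower , upper = meet-bounds r (ℕ.+-cancelˡ-< (suc (size l)) _ _ i<j) (right-≤ (size l) j≤)
  in ℕ.+-monoʳ-≤ (suc (size l)) lower , ℕ.+-monoʳ-< (suc (size l)) upper

-- The bounds leave one value. Thus every node is reached, and by an adjacent pair that can
-- represent its block.
meet-adjacent : ∀ t {k} → k < size t → meet t k (suc k) ≡ k
meet-adjacent t k< = let lower , upper = meet-bounds t (ℕ.n<1+n _) k< in
  ℕ.≤-antisym (s≤s⁻¹ upper) lower

-- The value at the widest pair is the size of the left subtree, so the split at the root can be
-- read off; restricting to either side recovers the subtrees.
meet-injective : ∀ t t′ → size t ≡ size t′ →
                 (∀ {i j} → i < j → j ≤ size t → meet t i j ≡ meet t′ i j) → t ≡ t′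
meet-injective leaf       leaf         _  _ = refl
meet-injective (node l r) (node l′ r′) eq h = cong₂ node l≡l′ r≡r′
  where
  sl≡sl′ : size l ≡ size l′
  sl≡sl′ = trans (sym (meet-cross l r z≤n (s≤s (ℕ.m≤m+n _ (size r)))))
          (trans (h (s≤s z≤n) ℕ.≤-refl)
                 (meet-cross l′ r′ z≤n (subst (size l′ <_) (sym eq) (s≤s (ℕ.m≤m+n _ (size r′))))))

  sr≡sr′ : size r ≡ size r′
  sr≡sr′ = ℕ.+-cancelˡ-≡ (size l) _ _
    (trans (ℕ.suc-injective eq) (cong (_+ size r′) (sym sl≡sl′)))

  l≡l′ : l ≡ l′
  l≡l′ = meet-injective l l′ sl≡sl′ λ i<j j≤ →
    trans (sym (meet-left l r j≤))
   (trans (h i<j (ℕ.≤-trans j≤ (ℕ.m≤n⇒m≤1+n (ℕ.m≤m+n _ _))))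
          (meet-left l′ r′ (ℕ.≤-trans j≤ (ℕ.≤-reflexive sl≡sl′))))

  r≡r′ : r ≡ r′
  r≡r′ = meet-injective r r′ sr≡sr′ λ {i} {j} i<j j≤ →
    ℕ.+-cancelˡ-≡ (suc (size l)) _ _
      (trans (sym (meet-right l r i j))
      (trans (h (ℕ.+-monoʳ-< (suc (size l)) i<j) (s≤s (ℕ.+-monoʳ-≤ (size l) j≤)))
      (trans (cong (λ s → meet (node l′ r′) (suc s + i) (suc s + j)) sl≡sl′)
      (trans (meet-right l′ r′ i j)
             (cong (λ s → suc s + meet r′ i j) (sym sl≡sl′))))))

-- A function satisfying the hypotheses is split by its value s at the widest
-- interval: it equals s at every (i , j) with i ≤ s < j.
meet-surjective : ∀ b m (g : ℕ → ℕ → ℕ) → m ≤ b →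
  (∀ {i j} → i < j → j ≤ m → i ≤ g i j × g i j < j) →
  (∀ {i k j} → i < k → k < j → j ≤ m → g i j ≡ g i k ⊎ g i j ≡ g k j) →
  ∃ λ t → size t ≡ m × (∀ {i j} → i < j → j ≤ m → meet t i j ≡ g i j)
meet-surjective b       zero    g _   _      _        =
  leaf , refl , λ { i<j z≤n → contradiction i<j ℕ.n≮0 }
-- The fuel `b` drives the recursion, since neither `s` nor `m ∸ s` is structurally smaller than
-- `suc m`.
meet-surjective (suc b) (suc m) g m≤b bounds triangle =
  let s≤m = s≤s⁻¹ (proj₂ (bounds (s≤s z≤n) ℕ.≤-refl))
      l , l-size , l-meet = meet-surjective b s g (ℕ.≤-trans s≤m (s≤s⁻¹ m≤b))
        (λ i<j j≤ → bounds i<j (ℕ.≤-trans j≤ (ℕ.m≤n⇒m≤1+n s≤m)))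
        (λ i<k k<j j≤ → triangle i<k k<j (ℕ.≤-trans j≤ (ℕ.m≤n⇒m≤1+n s≤m)))
      in-range : ∀ {j} → j ≤ m ∸ s → suc s + j ≤ suc m
      in-range {j} j≤ = s≤s (subst (s + j ≤_) (ℕ.m+[n∸m]≡n s≤m) (ℕ.+-monoʳ-≤ s j≤))
      -- The right part is translated to start at 0, in arguments and values alike. The truncated
      -- subtraction is exact because a value there is at least its left endpoint.
      r , r-size , r-meet = meet-surjective b (m ∸ s) (λ i j → g (suc s + i) (suc s + j) ∸ suc s)
        (ℕ.≤-trans (ℕ.m∸n≤m m s) (s≤s⁻¹ m≤b))
        (λ {i} {j} i<j j≤ →
          let lower , upper = bounds (ℕ.+-monoʳ-< (suc s) i<j) (in-range j≤)
          in ℕ.≤-trans (ℕ.≤-reflexive (sym (ℕ.m+n∸m≡n s i))) (ℕ.∸-monoˡ-≤ (suc s) lower)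
           , ℕ.<-≤-trans (ℕ.∸-monoˡ-< upper (ℕ.≤-trans (s≤s (ℕ.m≤m+n s i)) lower))
                         (ℕ.≤-reflexive (ℕ.m+n∸m≡n s j)))
        (λ i<k k<j j≤ → Sum⊎.map (cong (_∸ suc s)) (cong (_∸ suc s))
          (triangle (ℕ.+-monoʳ-< (suc s) i<k) (ℕ.+-monoʳ-< (suc s) k<j) (in-range j≤)))
  in node l r
   , cong suc (trans (cong₂ _+_ l-size r-size) (ℕ.m+[n∸m]≡n s≤m))
   , agree l r l-size (trans r-size (cong (m ∸_) (sym l-size))) l-meet r-meet
  where
  s = g 0 (suc m)

  -- In the triangle 0, i, m + 1 the pair (0 , i) cannot have the value `s`, because its value is
  -- below i ≤ s.
  spanning : ∀ {i} → i ≤ s → g i (suc m) ≡ s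
  spanning {zero}  _   = refl
  spanning {suc i} i≤s with ℕ.m≤n⇒m<n∨m≡n (ℕ.≤-trans i≤s (ℕ.<⇒≤ (proj₂ (bounds (s≤s z≤n) ℕ.≤-refl))))
  ... | inj₂ refl = contradiction i≤s (ℕ.<⇒≱ (proj₂ (bounds (s≤s z≤n) ℕ.≤-refl)))
  ... | inj₁ i<m with triangle (s≤s z≤n) i<m ℕ.≤-refl
  ...   | inj₁ eq = contradiction i≤s
    (ℕ.<⇒≱ (subst (_< suc i) (sym eq) (proj₂ (bounds (s≤s z≤n) (ℕ.<⇒≤ i<m)))))
  ...   | inj₂ eq = sym eq

  -- In the triangle i, j, m + 1 the pair (j , m + 1) cannot have the value `s`, because its value
  -- is at least j > s.
  crossing : ∀ {i j} → i ≤ s → s < j → j ≤ suc m → g i j ≡ s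
  crossing i≤s s<j j≤ with ℕ.m≤n⇒m<n∨m≡n j≤
  ... | inj₂ refl = spanning i≤s
  ... | inj₁ j<m with triangle (ℕ.≤-<-trans i≤s s<j) j<m ℕ.≤-refl
  ...   | inj₁ eq = trans (sym eq) (spanning i≤s)
  ...   | inj₂ eq = contradiction s<j
    (ℕ.≤⇒≯ (subst (_ ≤_) (trans (sym eq) (spanning i≤s)) (proj₁ (bounds j<m ℕ.≤-refl))))

  agree : ∀ l r → size l ≡ s → size r ≡ m ∸ size l →
          (∀ {i j} → i < j → j ≤ s → meet l i j ≡ g i j) →
          (∀ {i j} → i < j → j ≤ m ∸ s → meet r i j ≡ g (suc s + i) (suc s + j) ∸ suc s) →
          ∀ {i j} → i < j → j ≤ suc m → meet (node l r) i j ≡ g i j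
  agree l r l-size r-size l-meet r-meet {i} {j} i<j j≤ with position (size l) i j
  ... | left j≤s = l-meet i<j (subst (j ≤_) l-size j≤s)
  ... | cross i≤s s<j =
    trans l-size (sym (crossing (subst (i ≤_) l-size i≤s) (subst (_< j) l-size s<j) j≤))
  ... | right i′ j′ rewrite l-size =
    trans (cong (suc s +_) (r-meet (ℕ.+-cancelˡ-< (suc s) _ _ i<j)
             (subst (_≤ m ∸ s) (ℕ.m+n∸m≡n s j′) (ℕ.∸-monoˡ-≤ (suc s) j≤))))
          (ℕ.m+[n∸m]≡n (ℕ.≤-trans (s≤s (ℕ.m≤m+n s i′)) (proj₁ (bounds i<j j≤))))

-- Leftmost leaves and weights

data Place (s : ℕ) : ℕ → Set where
  below : ∀ {k} → k < s → Place s k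
  at    : ∀ {k} → k ≡ s → Place s k
  above : ∀ k → Place s (suc s + k)

place : ∀ s k → Place s k
place s k with ℕ.<-cmp k s
... | tri< k<s _ _ = below k<s
... | tri≈ _ k≡s _ = at k≡s
... | tri> _ _ s<k = subst (Place s) (ℕ.m+[n∸m]≡n s<k) (above (k ∸ suc s))

-- The leftmost leaf below the internal node `k`: the least source among the edges whose ends meet
-- at `k`.
leftmost : Tree → ℕ → ℕ
leftmost leaf       k = 0
leftmost (node l r) k with place (size l) k
... | below _  = leftmost l k
... | at _     = 0
... | above k′ = suc (size l) + leftmost r k′

leftmost-below : ∀ l r {k} → k < size l → leftmost (node l r) k ≡ leftmost l k
leftmost-below l r {k} k<s with place (size l) k
... | below _  = refl
... | at k≡s   = contradiction k<s (ℕ.<-irrefl k≡s)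
... | above k′ = contradiction k<s (ℕ.≤⇒≯ (ℕ.m≤n⇒m≤1+n (ℕ.m≤m+n _ k′)))

leftmost-at : ∀ l r → leftmost (node l r) (size l) ≡ 0
leftmost-at l r = go refl
  where
  go : ∀ {k} → k ≡ size l → leftmost (node l r) k ≡ 0
  go {k} k≡s with place (size l) k
  ... | below k<s = contradiction k<s (ℕ.<-irrefl k≡s)
  ... | at _      = refl
  ... | above k′  = contradiction (sym k≡s) (ℕ.<⇒≢ (s≤s (ℕ.m≤m+n _ k′)))

leftmost-above : ∀ l r k → leftmost (node l r) (suc (size l) + k) ≡ suc (size l) + leftmost r k
leftmost-above l r k = trans (go (s≤s (ℕ.m≤m+n _ k)))
  (cong (λ k → suc (size l) + leftmost r k) (ℕ.m+n∸m≡n (size l) k))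
  where
  go : ∀ {k} → size l < k → leftmost (node l r) k ≡ suc (size l) + leftmost r (k ∸ suc (size l))
  go {k} s<k with place (size l) k
  ... | below k<s = contradiction s<k (ℕ.<-asym k<s)
  ... | at k≡s    = contradiction s<k (ℕ.<-irrefl (sym k≡s))
  ... | above k′  = cong (λ k → suc (size l) + leftmost r k) (sym (ℕ.m+n∸m≡n (size l) k′))

-- Moving the left end of a pair to the leftmost leaf below its node keeps that end in the left
-- subtree of the node, so the node stays the same. The leftmost leaf is thus a lower bound for the
-- sources of a block, and it is attained.
leftmost-meet : ∀ t {i j} → i < j → j ≤ size t →
                leftmost t (meet t i j) ≤ i ×
                meet t (leftmost t (meet t i j)) j ≡ meet t i j
leftmost-meet leaf       i<j z≤n = contradiction i<j ℕ.n≮0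
leftmost-meet (node l r) {i} {j} i<j j≤ with position (size l) i j
... | left j≤s rewrite leftmost-below l r (ℕ.<-≤-trans (proj₂ (meet-bounds l i<j j≤s)) j≤s) =
  let lower , eq = leftmost-meet l i<j j≤s in lower , trans (meet-left l r j≤s) eq
... | cross i≤s s<j rewrite leftmost-at l r = z≤n , meet-cross l r z≤n s<j
... | right i′ j′ rewrite leftmost-above l r (meet r i′ j′) =
  let lower , eq = leftmost-meet r (ℕ.+-cancelˡ-< (suc (size l)) _ _ i<j) (right-≤ (size l) j≤)
  in ℕ.+-monoʳ-≤ (suc (size l)) lower
   , trans (meet-right l r (leftmost r (meet r i′ j′)) j′) (cong (suc (size l) +_) eq)

-- `suc (size r)` counts the leaves of the right subtree; the edges to them from the leftmost leaf
-- below the node are the minimal edges of its block.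
weight : Tree → ℕ
weight leaf       = 0
weight (node l r) = suc (size r) + (weight l + weight r)

-- Counting over pairs i < j

∑< : ℕ → (ℕ → ℕ) → ℕ
∑< zero    f = 0
∑< (suc n) f = f 0 + ∑< n (f ∘ suc)

∑<-cong : ∀ n {f g : ℕ → ℕ} → (∀ {i} → i < n → f i ≡ g i) → ∑< n f ≡ ∑< n g
∑<-cong zero    h = refl
∑<-cong (suc n) h = cong₂ _+_ (h (s≤s z≤n)) (∑<-cong n (h ∘ s≤s))

∑<-const : ∀ n c → ∑< n (λ _ → c) ≡ n ℕ.* c
∑<-const zero    c = refl
∑<-const (suc n) c = cong (c +_) (∑<-const n c)

∑<-+ : ∀ m n f → ∑< (m + n) f ≡ ∑< m f + ∑< n (f ∘ (m +_))
∑<-+ zero    n f = refl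
∑<-+ (suc m) n f = trans (cong (f 0 +_) (∑<-+ m n (f ∘ suc))) (sym (ℕ.+-assoc (f 0) _ _))

-- The vertex 0 is peeled off as in `edges`, which makes `sum-edges` an induction.
∑<< : ℕ → (ℕ → ℕ → ℕ) → ℕ
∑<< zero    f = 0
∑<< (suc n) f = ∑< n (f 0 ∘ suc) + ∑<< n (λ i j → f (suc i) (suc j))

∑<<-cong : ∀ n {f g : ℕ → ℕ → ℕ} → (∀ {i j} → i < j → j < n → f i j ≡ g i j) →
           ∑<< n f ≡ ∑<< n g
∑<<-cong zero    h = refl
∑<<-cong (suc n) h = cong₂ _+_ (∑<-cong n (λ j<n → h (s≤s z≤n) (s≤s j<n)))
                               (∑<<-cong n (λ i<j j<n → h (s≤s i<j) (s≤s j<n)))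

-- The three terms are the three cases of `Position` at a root with m leaves on its left and n on
-- its right.
∑<<-+ : ∀ m n f → ∑<< (m + n) f ≡
        ∑<< m f + ∑< m (λ i → ∑< n (λ j → f i (m + j))) + ∑<< n (λ i j → f (m + i) (m + j))
∑<<-+ zero    n f = refl
∑<<-+ (suc m) n f = trans
  (cong₂ _+_ (∑<-+ m n (f 0 ∘ suc)) (∑<<-+ m n (λ i j → f (suc i) (suc j))))
  (rearrange (∑< m (f 0 ∘ suc)) _ _ _ _)
  where
  rearrange : ∀ a b c d e → a + b + (c + d + e) ≡ a + c + (b + d) + e
  rearrange = solve-∀

-- Indicator of minimality read off the tree; `counted` and `uncounted` compare it with `IsMinimal`.
isLeftmost : Tree → ℕ → ℕ → ℕ
isLeftmost t i j = if leftmost t (meet t i j) ≡ᵇ i then 1 else 0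

≡ᵇ-+ : ∀ m x y → (m + x ≡ᵇ m + y) ≡ (x ≡ᵇ y)
≡ᵇ-+ zero    x y = refl
≡ᵇ-+ (suc m) x y = ≡ᵇ-+ m x y

-- Pairs inside one subtree are counted recursively. Of the pairs meeting at the root only those
-- with i = 0 count, one for each leaf on the right.
∑<<-isLeftmost : ∀ t → ∑<< (suc (size t)) (isLeftmost t) ≡ weight t
∑<<-isLeftmost leaf       = refl
∑<<-isLeftmost (node l r) = begin
  ∑<< (suc (suc (size l + size r))) f
    ≡⟨ cong (λ n → ∑<< (suc n) f) (sym (ℕ.+-suc (size l) (size r))) ⟩
  ∑<< (sl + sr) f
    ≡⟨ ∑<<-+ sl sr f ⟩
  ∑<< sl f + ∑< sl (λ i → ∑< sr (λ j → f i (sl + j))) + ∑<< sr (λ i j → f (sl + i) (sl + j))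
    ≡⟨ cong₂ _+_ (cong₂ _+_ (trans (∑<<-cong sl within-l) (∑<<-isLeftmost l)) across)
                 (trans (∑<<-cong sr within-r) (∑<<-isLeftmost r)) ⟩
  weight l + sr + weight r
    ≡⟨ rearrange (weight l) sr (weight r) ⟩
  sr + (weight l + weight r) ∎
  where
  open ≡-Reasoning
  f  = isLeftmost (node l r)
  sl = suc (size l)
  sr = suc (size r)

  rearrange : ∀ a b c → a + b + c ≡ b + (a + c)
  rearrange = solve-∀

  within-l : ∀ {i j} → i < j → j < sl → f i j ≡ isLeftmost l i j
  within-l {i} i<j (s≤s j≤s) rewrite meet-left l r {i} j≤s
    | leftmost-below l r (ℕ.<-≤-trans (proj₂ (meet-bounds l i<j j≤s)) j≤s) = refl

  within-r : ∀ {i j} → i < j → j < sr → f (sl + i) (sl + j) ≡ isLeftmost r i j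
  within-r {i} {j} _ _ rewrite meet-right l r i j | leftmost-above l r (meet r i j)
    | ≡ᵇ-+ (size l) (leftmost r (meet r i j)) i = refl

  f-cross : ∀ {i} → i < sl → ∀ j → f i (sl + j) ≡ (if 0 ≡ᵇ i then 1 else 0)
  f-cross {i} (s≤s i≤s) j rewrite meet-cross l r i≤s (s≤s (ℕ.m≤m+n (size l) j))
    | leftmost-at l r = refl

  across : ∑< sl (λ i → ∑< sr (λ j → f i (sl + j))) ≡ sr
  across = trans
    (∑<-cong sl (λ i<sl → trans (∑<-cong sr (λ {j} _ → f-cross i<sl j)) (∑<-const sr _)))
    (trans (cong₂ _+_ (ℕ.*-identityʳ sr)
                      (trans (∑<-cong (size l) (λ _ → ℕ.*-zeroʳ sr))
                             (trans (∑<-const (size l) 0) (ℕ.*-zeroʳ (size l)))))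
           (ℕ.+-identityʳ sr))

-- Partitions presented by a tree

meetᴱ : ∀ {n} → Tree → Edge n → ℕ
meetᴱ t e = meet t (toℕ (src e)) (toℕ (tgt e))

infix 4 _presents_

-- Only coincidence of labels is compared with coincidence of nodes, because the numbering of the
-- blocks is arbitrary.
_presents_ : ∀ {n k} → Labelling n k → Tree → Set
p presents t = ∀ e f → SameBlock p e f ⇔ meetᴱ t e ≡ meetᴱ t f

edgeℕ : ∀ {n i j} → i < j → j < n → Edge n
edgeℕ i<j j<n = edge (fromℕ< (ℕ.<-trans i<j j<n)) (fromℕ< j<n)
  (subst₂ _<_ (sym (Fin.toℕ-fromℕ< _)) (sym (Fin.toℕ-fromℕ< j<n)) i<j)

meetᴱ-edgeℕ : ∀ {n} t {i j} (i<j : i < j) (j<n : j < n) → meetᴱ t (edgeℕ i<j j<n) ≡ meet t i j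
meetᴱ-edgeℕ t i<j j<n = cong₂ (meet t) (Fin.toℕ-fromℕ< _) (Fin.toℕ-fromℕ< j<n)

tgt≤ : ∀ {n} (e : Edge (suc n)) → toℕ (tgt e) ≤ n
tgt≤ e = s≤s⁻¹ (Fin.toℕ<n (tgt e))

length-filter : ∀ {A : Set} {P : A → Set} (P? : U.Decidable P) (f : A → ℕ) →
  (∀ {x} → P x → f x ≡ 1) → (∀ {x} → ¬ P x → f x ≡ 0) →
  ∀ xs → length (filter P? xs) ≡ sum (map f xs)
length-filter P? f f≡1 f≡0 []       = refl
length-filter P? f f≡1 f≡0 (x ∷ xs) with P? x
... | yes px = cong₂ _+_ (sym (f≡1 px)) (length-filter P? f f≡1 f≡0 xs)
... | no ¬px = cong₂ _+_ (sym (f≡0 ¬px)) (length-filter P? f f≡1 f≡0 xs)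

sum-allFin : ∀ n (f : ℕ → ℕ) → sum (map (f ∘ toℕ) (allFin n)) ≡ ∑< n f
sum-allFin n f = trans (cong sum (List.map-tabulate {n = n} id (f ∘ toℕ))) (go n f)
  where
  go : ∀ n (f : ℕ → ℕ) → sum (tabulate {n = n} (f ∘ toℕ)) ≡ ∑< n f
  go zero    f = refl
  go (suc n) f = cong (f 0 +_) (go n (f ∘ suc))

sum-edges : ∀ n (f : ℕ → ℕ → ℕ) →
            sum (map (λ e → f (toℕ (src e)) (toℕ (tgt e))) (edges n)) ≡ ∑<< n f
sum-edges zero    f = refl
sum-edges (suc n) f = begin
  sum (map g (map fromZero (allFin n) ++ map shift (edges n)))
    ≡⟨ cong sum (List.map-++ g (map fromZero (allFin n)) (map shift (edges n))) ⟩
  sum (map g (map fromZero (allFin n)) ++ map g (map shift (edges n)))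
    ≡⟨ ℕ.sum-++ (map g (map fromZero (allFin n))) _ ⟩
  sum (map g (map fromZero (allFin n))) + sum (map g (map shift (edges n)))
    ≡⟨ cong₂ (λ xs ys → sum xs + sum ys) (sym (List.map-∘ (allFin n))) (sym (List.map-∘ (edges n))) ⟩
  sum (map (f 0 ∘ suc ∘ toℕ) (allFin n)) + sum (map (g ∘ shift) (edges n))
    ≡⟨ cong₂ _+_ (sum-allFin n (f 0 ∘ suc)) (sum-edges n (λ i j → f (suc i) (suc j))) ⟩
  ∑<< (suc n) f ∎
  where
  open ≡-Reasoning
  g : Edge (suc n) → ℕ
  g e = f (toℕ (src e)) (toℕ (tgt e))

-- An edge is minimal exactly when its source is the leftmost leaf below its node, which
-- `leftmost≤src` and `attained` identify as the least source of the block.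
minimal-presents : ∀ {k} t (p : Labelling (suc (size t)) k) → p presents t → minimal p ≡ weight t
minimal-presents t p pres = begin
  minimal p
    ≡⟨ length-filter (isMinimal? p) (λ e → isLeftmost t (toℕ (src e)) (toℕ (tgt e)))
                     counted uncounted (edges n) ⟩
  sum (map (λ e → isLeftmost t (toℕ (src e)) (toℕ (tgt e))) (edges n))
    ≡⟨ sum-edges n (isLeftmost t) ⟩
  ∑<< n (isLeftmost t)
    ≡⟨ ∑<<-isLeftmost t ⟩
  weight t ∎
  where
  open ≡-Reasoning
  n = suc (size t)

  leftmost≤src : ∀ e → leftmost t (meetᴱ t e) ≤ toℕ (src e)
  leftmost≤src e = proj₁ (leftmost-meet t (src<tgt e) (tgt≤ e))

  attained : ∀ e → ∃ λ f → SameBlock p f e × toℕ (src f) ≡ leftmost t (meetᴱ t e)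
  attained e =
    let i<j = ℕ.≤-<-trans (leftmost≤src e) (src<tgt e)
        -- The witness keeps the target of `e` and moves the source to the leftmost leaf.
        f   = edgeℕ i<j (Fin.toℕ<n (tgt e))
    in f
     , Equivalence.from (pres f e) (trans (meetᴱ-edgeℕ t i<j (Fin.toℕ<n (tgt e)))
                                          (proj₂ (leftmost-meet t (src<tgt e) (tgt≤ e))))
     , Fin.toℕ-fromℕ< _

  if-true : ∀ {x y} → x ≡ y → (if x ≡ᵇ y then 1 else 0) ≡ 1
  if-true {x} {y} x≡y with x ≡ᵇ y | ℕ.≡⇒≡ᵇ x y x≡y
  ... | true | _ = refl

  if-false : ∀ {x y} → x ≢ y → (if x ≡ᵇ y then 1 else 0) ≡ 0
  if-false {x} {y} x≢y with x ≡ᵇ y | ℕ.≡ᵇ⇒≡ x y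
  ... | true  | h = contradiction (h _) x≢y
  ... | false | _ = refl

  counted : ∀ {e} → IsMinimal p e → isLeftmost t (toℕ (src e)) (toℕ (tgt e)) ≡ 1
  counted {e} min = let f , same , src≡ = attained e in
    if-true (ℕ.≤-antisym (leftmost≤src e) (subst (toℕ (src e) ≤_) src≡ (min f same)))

  uncounted : ∀ {e} → ¬ IsMinimal p e → isLeftmost t (toℕ (src e)) (toℕ (tgt e)) ≡ 0
  uncounted {e} ¬min = if-false λ eq → ¬min λ f same →
    subst (_≤ toℕ (src f)) (trans (cong (leftmost t) (Equivalence.to (pres f e) same)) eq) (leftmost≤src f)

-- With k the node of (i , j) in `t`, the edges (i , j) and (k , k + 1) share a block, hence also a
-- node of `t′`; by adjacency that node is k.
presents-unique : ∀ {k} t t′ (p : Labelling (suc (size t)) k) → size t′ ≡ size t →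
                  p presents t → p presents t′ → t ≡ t′
presents-unique t t′ p size≡ pres pres′ = meet-injective t t′ (sym size≡) λ {i} {j} i<j j≤ →
  let lower , upper = meet-bounds t i<j j≤
      k     = meet t i j
      k<m   = ℕ.<-≤-trans upper j≤
      e     = edgeℕ i<j (s≤s j≤)
      f     = edgeℕ (ℕ.n<1+n k) (s≤s k<m)
      e∼f   = Equivalence.from (pres e f)
                (trans (meetᴱ-edgeℕ t i<j (s≤s j≤))
                (sym (trans (meetᴱ-edgeℕ t (ℕ.n<1+n k) (s≤s k<m)) (meet-adjacent t k<m))))
      k<m′  = subst (k <_) (sym size≡) k<m
  in sym (trans (sym (meetᴱ-edgeℕ t′ i<j (s≤s j≤)))
         (trans (Equivalence.to (pres′ e f) e∼f)
         (trans (meetᴱ-edgeℕ t′ (ℕ.n<1+n k) (s≤s k<m)) (meet-adjacent t′ k<m′))))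

label : ∀ t → Labelling (suc (size t)) (size t)
label t e = fromℕ< (ℕ.<-≤-trans (proj₂ (meet-bounds t (src<tgt e) (tgt≤ e))) (tgt≤ e))

toℕ-label : ∀ t e → toℕ (label t e) ≡ meetᴱ t e
toℕ-label t e = Fin.toℕ-fromℕ< _

label-presents : ∀ t → label t presents t
label-presents t e f = mk⇔
  (λ eq → trans (sym (toℕ-label t e)) (trans (cong toℕ eq) (toℕ-label t f)))
  (λ eq → Fin.toℕ-injective (trans (toℕ-label t e) (trans eq (sym (toℕ-label t f)))))

-- Closed walks in a tree

module _ {A : Set} {P Q : A → Set} (P⊎Q : ∀ x → P x ⊎ Q x) where

  path-crosses : ∀ {a b} vs → P a → Q b →
                 ∃₂ λ x y → (x , y) ∈ zip (a ∷ vs) (vs ∷ʳ b) × P x × Q y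
  path-crosses {a} {b} []       pa qb = a , b , here refl , pa , qb
  path-crosses {a}     (w ∷ vs) pa qb with P⊎Q w
  ... | inj₂ qw = a , w , here refl , pa , qw
  ... | inj₁ pw = let x , y , xy∈ , px , qy = path-crosses vs pw qb in x , y , there xy∈ , px , qy

module _ {A : Set} {P Q : A → Set} (P⊎Q : ∀ x → P x ⊎ Q x) (¬P×Q : ∀ {x} → P x → ¬ Q x) where

  -- A walk from P to P that visits Q must leave P and come back. The two ends are separate
  -- variables so that the recursion can advance the start.
  excursion : ∀ {a b} vs → P a → P b → Any Q vs →
              (∃₂ λ x y → (x , y) ∈ zip (a ∷ vs) (vs ∷ʳ b) × P x × Q y) ×
              (∃₂ λ x y → (x , y) ∈ zip (a ∷ vs) (vs ∷ʳ b) × Q x × P y)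
  excursion {a} (w ∷ vs) pa pb q∈ with P⊎Q w
  ... | inj₂ qw = let x , y , xy∈ , qx , py = path-crosses (swap ∘ P⊎Q) vs qw pb
                  in (a , w , here refl , pa , qw) , (x , y , there xy∈ , qx , py)
  excursion {a} (w ∷ vs) pa pb (here qw)  | inj₁ pw = contradiction qw (¬P×Q pw)
  excursion {a} (w ∷ vs) pa pb (there q∈) | inj₁ pw =
    let (x , y , xy∈ , px , qy) , (x′ , y′ , xy∈′ , qx′ , py′) = excursion vs pw pb q∈
    in (x , y , there xy∈ , px , qy) , (x′ , y′ , there xy∈′ , qx′ , py′)

-- If the starting vertex lies in Q, the excursion is taken with P and Q interchanged and its two
-- steps are swapped back.
cycle-crosses : ∀ {n} {P Q : Fin n → Set} → (∀ x → P x ⊎ Q x) → (∀ {x} → P x → ¬ Q x) →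
  ∀ c → Any P c → Any Q c →
  (∃₂ λ x y → (x , y) ∈ steps c × P x × Q y) × (∃₂ λ x y → (x , y) ∈ steps c × Q x × P y)
cycle-crosses P⊎Q disj (v ∷ vs) p∈ q∈ with P⊎Q v
cycle-crosses P⊎Q disj (v ∷ vs) p∈ (here qv)  | inj₁ pv = contradiction qv (disj pv)
cycle-crosses P⊎Q disj (v ∷ vs) p∈ (there q∈) | inj₁ pv = excursion P⊎Q disj vs pv pv q∈
cycle-crosses P⊎Q disj (v ∷ vs) (here pv)  q∈ | inj₂ qv = contradiction qv (disj pv)
cycle-crosses P⊎Q disj (v ∷ vs) (there p∈) q∈ | inj₂ qv =
  let down , up = excursion (swap ∘ P⊎Q) (λ qx px → disj px qx) vs qv qv p∈ in up , down

∈-zip⁻ : ∀ {A B : Set} (xs : List A) (ys : List B) {x y} →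
        (x , y) ∈ zip xs ys → x ∈ xs × y ∈ ys
∈-zip⁻ (x ∷ xs) (y ∷ ys) (here refl)  = here refl , here refl
∈-zip⁻ (x ∷ xs) (y ∷ ys) (there xy∈) =
  let x∈ , y∈ = ∈-zip⁻ xs ys xy∈ in there x∈ , there y∈

∈-steps⁻ : ∀ {n} (c : List (Fin n)) {x y} → (x , y) ∈ steps c → x ∈ c × y ∈ c
∈-steps⁻ (v ∷ vs) xy∈ with ∈-zip⁻ (v ∷ vs) (vs ∷ʳ v) xy∈
... | x∈ , y∈ with ∈-++⁻ vs y∈
...   | inj₁ y∈vs        = x∈ , there y∈vs
...   | inj₂ (here refl) = x∈ , here refl

-- Descend to the lowest node above all the vertices visited. The walk has vertices in both subtrees
-- there, so it crosses in both directions, and both crossing edges meet at that node. The map `φ`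
-- to leaf numbers absorbs the translation on entering a right subtree; its two distinct values
-- exclude a leaf.
opposite-steps : ∀ {n} t (φ : Fin n → ℕ) c → All (λ v → φ v ≤ size t) c →
  (∃₂ λ v w → v ∈ c × w ∈ c × φ v ≢ φ w) →
  ∃₂ λ x y → ∃₂ λ x′ y′ → (x , y) ∈ steps c × (y′ , x′) ∈ steps c ×
    φ x < φ y × φ x′ < φ y′ × meet t (φ x) (φ y) ≡ meet t (φ x′) (φ y′)
opposite-steps leaf φ c φ≤ (v , w , v∈ , w∈ , v≢w) = contradiction
  (trans (ℕ.n≤0⇒n≡0 (All.lookup φ≤ v∈)) (sym (ℕ.n≤0⇒n≡0 (All.lookup φ≤ w∈)))) v≢w
opposite-steps {n} (node l r) φ c φ≤ (v , w , v∈ , w∈ , v≢w)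
  with All.all? (λ v → φ v ℕ.≤? size l) c | All.all? (λ v → size l ℕ.<? φ v) c
... | yes φ≤s | _ =
  let x , y , x′ , y′ , xy∈ , yx∈ , x<y , x′<y′ , eq = opposite-steps l φ c φ≤s (v , w , v∈ , w∈ , v≢w)
  in x , y , x′ , y′ , xy∈ , yx∈ , x<y , x′<y′
   , trans (meet-left l r (All.lookup φ≤s (proj₂ (∈-steps⁻ c xy∈))))
    (trans eq (sym (meet-left l r (All.lookup φ≤s (proj₁ (∈-steps⁻ c yx∈))))))
... | no _ | yes s<φ =
  let x , y , x′ , y′ , xy∈ , yx∈ , x<y , x′<y′ , eq = opposite-steps r (λ v → φ v ∸ suc (size l)) c
        (All.map (λ {v} φ≤ → subst (φ v ∸ suc (size l) ≤_) (ℕ.m+n∸m≡n (size l) (size r))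
                               (ℕ.∸-monoˡ-≤ (suc (size l)) φ≤)) φ≤)
        (v , w , v∈ , w∈ , λ eq → v≢w (ℕ.∸-cancelʳ-≡ (All.lookup s<φ v∈) (All.lookup s<φ w∈) eq))
      x∈ , y∈ = ∈-steps⁻ c xy∈
      y∈′ , x∈′ = ∈-steps⁻ c yx∈
  in x , y , x′ , y′ , xy∈ , yx∈
   , ℕ.≰⇒> (ℕ.<⇒≱ x<y ∘ ℕ.∸-monoˡ-≤ (suc (size l)))
   , ℕ.≰⇒> (ℕ.<⇒≱ x′<y′ ∘ ℕ.∸-monoˡ-≤ (suc (size l)))
   , trans (meet-right-∸ l r (All.lookup s<φ x∈) (All.lookup s<φ y∈))
    (trans (cong (suc (size l) +_) eq)
           (sym (meet-right-∸ l r (All.lookup s<φ x∈′) (All.lookup s<φ y∈′))))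
... | no ¬φ≤s | no ¬s<φ =
  let (x , y , xy∈ , x≤s , s<y) , (y′ , x′ , yx∈ , s<y′ , x′≤s) =
        cycle-crosses {n} {λ v → φ v ≤ size l} {λ v → size l < φ v}
          (λ v → ℕ.≤-<-connex (φ v) (size l)) ℕ.≤⇒≯ c
          (Any.map ℕ.≮⇒≥ (All.¬All⇒Any¬ (λ v → size l ℕ.<? φ v) c ¬s<φ))
          (Any.map ℕ.≰⇒> (All.¬All⇒Any¬ (λ v → φ v ℕ.≤? size l) c ¬φ≤s))
  in x , y , x′ , y′ , xy∈ , yx∈ , ℕ.≤-<-trans x≤s s<y , ℕ.≤-<-trans x′≤s s<y′
   , trans (meet-cross l r x≤s s<y) (sym (meet-cross l r x′≤s s<y′))

label-isTransitivePartition : ∀ t → IsTransitivePartition (label t)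
label-isTransitivePartition t = surj , trans′
  where
  surj : ∀ b → ∃ λ e → label t e ≡ b
  surj b = let k<m = Fin.toℕ<n b ; e = edgeℕ (ℕ.n<1+n _) (s≤s k<m) in
    e , Fin.toℕ-injective (trans (toℕ-label t e)
          (trans (meetᴱ-edgeℕ t (ℕ.n<1+n _) (s≤s k<m)) (meet-adjacent t k<m)))

  distinct : ∀ {n} (c : List (Fin n)) → IsCycle c → ∃₂ λ v w → v ∈ c × w ∈ c × toℕ v ≢ toℕ w
  distinct (v ∷ w ∷ _) (((v≢w ∷ _) ∷ _) , _) =
    v , w , here refl , there (here refl) , v≢w ∘ Fin.toℕ-injective
  distinct (v ∷ [])    (_ , s≤s ())
  distinct []          (_ , ())

  trans′ : IsTransitive (label t)
  trans′ c cyc =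
    let x , y , x′ , y′ , xy∈ , yx∈ , x<y , x′<y′ , eq =
          opposite-steps t toℕ c (All.tabulate (λ {v} _ → s≤s⁻¹ (Fin.toℕ<n v))) (distinct c cyc)
        e = edge x y x<y ; f = edge x′ y′ x′<y′
    in e , f , xy∈ , yx∈ , Equivalence.from (label-presents t e f) eq

-- From a partition to its tree

-- A missed value could be punched out, which would inject the set into a smaller one.
injective⇒surjective : ∀ {m} {f : Fin m → Fin m} → Injective _≡_ _≡_ f → ∀ y → ∃ λ x → f x ≡ y
injective⇒surjective {suc m} {f} inj y with Fin.any? (λ x → f x Fin.≟ y)
... | yes hit  = hit
... | no  miss = contradiction
  (λ {x} {x′} eq → inj (Fin.punchOut-injective (miss ∘ (x ,_) ∘ sym) (miss ∘ (x′ ,_) ∘ sym) eq))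
  (Fin.<⇒notInjective (ℕ.n<1+n m))

module _ {m} (p : Labelling (suc m) m) (p-partition : IsTransitivePartition p) where

  -- Of the three steps of the traversal i, k, j only the closing one runs against its edge, so that
  -- edge is (i , j), and it shares a block with one of the other two.
  triangle : ∀ {i k j} (i<k : i Fin.< k) (k<j : k Fin.< j) (i<j : i Fin.< j) →
             p (edge i j i<j) ≡ p (edge i k i<k) ⊎ p (edge i j i<j) ≡ p (edge k j k<j)
  triangle {i} {k} {j} i<k k<j i<j
    with proj₂ p-partition (i ∷ k ∷ j ∷ [])
           ( ((λ { refl → ℕ.<-irrefl refl i<k }) ∷ (λ { refl → ℕ.<-irrefl refl i<j }) ∷ []) ∷
             ((λ { refl → ℕ.<-irrefl refl k<j }) ∷ []) ∷ [] ∷ []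
           , s≤s (s≤s (s≤s z≤n)))
  ... | e , f , e∈ , f∈ , same = Sum⊎.map same-block same-block (along e e∈)
    where
    along : ∀ e → (src e , tgt e) ∈ steps (i ∷ k ∷ j ∷ []) → e ≡ edge i k i<k ⊎ e ≡ edge k j k<j
    along e              (here refl)                 = inj₁ (edge-≡ refl refl)
    along e              (there (here refl))         = inj₂ (edge-≡ refl refl)
    along (edge _ _ j<i) (there (there (here refl))) = contradiction j<i (ℕ.<-asym i<j)

    against : ∀ f → (tgt f , src f) ∈ steps (i ∷ k ∷ j ∷ []) → f ≡ edge i j i<j
    against (edge _ _ k<i) (here refl)                 = contradiction k<i (ℕ.<-asym i<k)
    against (edge _ _ j<k) (there (here refl))         = contradiction j<k (ℕ.<-asym k<j)
    against f              (there (there (here refl))) = edge-≡ refl refl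

    same-block : ∀ {g} → e ≡ g → p (edge i j i<j) ≡ p g
    same-block e≡g = trans (cong p (sym (against f f∈))) (trans (sym same) (cong p e≡g))

  adjacent : Fin m → Edge (suc m)
  adjacent k = edge (inject₁ k) (suc k) (s≤s (ℕ.≤-reflexive (Fin.toℕ-inject₁ k)))

  ≡-adjacent : ∀ {e k} → toℕ (src e) ≡ toℕ k → toℕ (tgt e) ≡ suc (toℕ k) → e ≡ adjacent k
  ≡-adjacent {k = k} src≡ tgt≡ =
    edge-≡ (Fin.toℕ-injective (trans src≡ (sym (Fin.toℕ-inject₁ k)))) (Fin.toℕ-injective tgt≡)

  -- The triangle on the source, its successor and the target either yields the adjacent edge at the
  -- source or passes to the edge starting one vertex later; `d` bounds the number of passes.
  adjacent-representative : ∀ d e → toℕ (tgt e) ≤ suc (d + toℕ (src e)) →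
    ∃ λ k → p e ≡ p (adjacent k) × toℕ (src e) ≤ toℕ k × toℕ k < toℕ (tgt e)
  adjacent-representative d e@(edge i j i<j) near = go d near (ℕ.m≤n⇒m<n∨m≡n i<j)
    where
    i<m : toℕ i < m
    i<m = ℕ.<-≤-trans i<j (tgt≤ e)

    k : Fin m
    k = fromℕ< i<m

    i≡k : toℕ i ≡ toℕ k
    i≡k = sym (Fin.toℕ-fromℕ< i<m)

    go : ∀ d → toℕ j ≤ suc (d + toℕ i) → suc (toℕ i) < toℕ j ⊎ suc (toℕ i) ≡ toℕ j →
         ∃ λ k → p e ≡ p (adjacent k) × toℕ i ≤ toℕ k × toℕ k < toℕ j
    go d       near (inj₂ eq)   = k , cong p (≡-adjacent i≡k (trans (sym eq) (cong suc i≡k)))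
                                , ℕ.≤-reflexive i≡k , subst (_< toℕ j) i≡k i<j
    go zero    near (inj₁ si<j) = contradiction near (ℕ.<⇒≱ si<j)
    go (suc d) near (inj₁ si<j)
      with triangle {i} {suc k} {j} (s≤s (ℕ.≤-reflexive i≡k))
                    (subst (λ x → suc x < toℕ j) i≡k si<j) i<j
    ... | inj₁ eq = k , trans eq (cong p (≡-adjacent i≡k refl))
                  , ℕ.≤-reflexive i≡k , subst (_< toℕ j) i≡k i<j
    ... | inj₂ eq =
      let k′ , same , k≤k′ , k′<j = adjacent-representative d
            (edge (suc k) j (subst (λ x → suc x < toℕ j) i≡k si<j))
            (subst (λ x → toℕ j ≤ suc x)
                   (trans (sym (ℕ.+-suc d (toℕ i))) (cong (λ x → d + suc x) i≡k)) near)
      in k′ , trans eq same , ℕ.≤-trans (ℕ.≤-reflexive i≡k) (ℕ.<⇒≤ k≤k′) , k′<j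

  representative : ∀ e → ∃ λ k → p e ≡ p (adjacent k) × toℕ (src e) ≤ toℕ k × toℕ k < toℕ (tgt e)
  representative e = adjacent-representative (toℕ (tgt e)) e (ℕ.m≤n⇒m≤1+n (ℕ.m≤m+n _ _))

  -- Renames a block by an adjacent edge inside it, found from the edge that witnesses that the
  -- block is nonempty.
  relabel : Fin m → Fin m
  relabel b = proj₁ (representative (proj₁ (proj₁ p-partition b)))

  p-adjacent-relabel : ∀ b → p (adjacent (relabel b)) ≡ b
  p-adjacent-relabel b = let e , pe≡b = proj₁ p-partition b in
    trans (sym (proj₁ (proj₂ (representative e)))) pe≡b

  relabel-injective : Injective _≡_ _≡_ relabel
  relabel-injective {a} {b} eq =
    trans (sym (p-adjacent-relabel a)) (trans (cong (p ∘ adjacent) eq) (p-adjacent-relabel b))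

  -- Here the number of blocks enters: there are as many blocks as adjacent edges, so the injection
  -- `relabel` is onto and each block contains exactly one adjacent edge.
  relabel-p-adjacent : ∀ k → relabel (p (adjacent k)) ≡ k
  relabel-p-adjacent k with injective⇒surjective relabel-injective k
  ... | b , refl = cong relabel (p-adjacent-relabel b)

  -- The representative found from `e` itself satisfies the bounds, and uniqueness of the adjacent
  -- edge in a block identifies it with the one chosen by `relabel`.
  relabel-p-bounds : ∀ e → toℕ (src e) ≤ toℕ (relabel (p e)) × toℕ (relabel (p e)) < toℕ (tgt e)
  relabel-p-bounds e with representative e
  ... | k , same , bounds rewrite same | relabel-p-adjacent k = bounds

  -- Extended to all pairs of naturals to fit `meet-surjective`, whose hypotheses and conclusion
  -- concern only i < j ≤ m; outside that range the value is the filler 0.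
  labelℕ : ℕ → ℕ → ℕ
  labelℕ i j with i ℕ.<? j | j ℕ.<? suc m
  ... | yes i<j | yes j<n = toℕ (relabel (p (edgeℕ i<j j<n)))
  ... | _       | _       = 0

  labelℕ-edge : ∀ e {i j} → toℕ (src e) ≡ i → toℕ (tgt e) ≡ j → labelℕ i j ≡ toℕ (relabel (p e))
  labelℕ-edge e refl refl with toℕ (src e) ℕ.<? toℕ (tgt e) | toℕ (tgt e) ℕ.<? suc m
  ... | yes i<j | yes j<n = cong (toℕ ∘ relabel ∘ p) (edge-≡ (Fin.fromℕ<-toℕ _ _) (Fin.fromℕ<-toℕ _ j<n))
  ... | no  i≮j | _       = contradiction (src<tgt e) i≮j
  ... | yes _   | no  j≮n = contradiction (Fin.toℕ<n (tgt e)) j≮n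

  tree-presenting : ∃ λ t → size t ≡ m × p presents t
  tree-presenting =
    let t , size≡ , meet≡ = meet-surjective m m labelℕ ℕ.≤-refl bounds triangleℕ
        meetᴱ≡ : ∀ e → meetᴱ t e ≡ toℕ (relabel (p e))
        meetᴱ≡ e = trans (meet≡ (src<tgt e) (tgt≤ e)) (labelℕ-edge e refl refl)
    in t , size≡ , λ e f → mk⇔
         (λ same → trans (meetᴱ≡ e) (trans (cong (toℕ ∘ relabel) same) (sym (meetᴱ≡ f))))
         (λ eq → relabel-injective (Fin.toℕ-injective (trans (sym (meetᴱ≡ e)) (trans eq (meetᴱ≡ f)))))
    where
    bounds : ∀ {i j} → i < j → j ≤ m → i ≤ labelℕ i j × labelℕ i j < j
    bounds i<j j≤m =
      let e      = edgeℕ i<j (s≤s j≤m)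
          src≡   = Fin.toℕ-fromℕ< (ℕ.<-trans i<j (s≤s j≤m))
          tgt≡   = Fin.toℕ-fromℕ< (s≤s j≤m)
          label≡ = sym (labelℕ-edge e src≡ tgt≡)
          lower , upper = relabel-p-bounds e
      in subst₂ _≤_ src≡ label≡ lower , subst₂ _<_ label≡ tgt≡ upper

    triangleℕ : ∀ {i k j} → i < k → k < j → j ≤ m →
                labelℕ i j ≡ labelℕ i k ⊎ labelℕ i j ≡ labelℕ k j
    triangleℕ {i} {k} {j} i<k k<j j≤m = Sum⊎.map
      (λ same → trans (labelℕ-edge ij at-i at-j)
        (trans (cong (toℕ ∘ relabel) same) (sym (labelℕ-edge ik at-i at-k))))
      (λ same → trans (labelℕ-edge ij at-i at-j)
        (trans (cong (toℕ ∘ relabel) same) (sym (labelℕ-edge kj at-k at-j))))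
      (triangle (src<tgt ik) (src<tgt kj) (src<tgt ij))
      where
      vertex : ∀ {v} → v ≤ j → Fin (suc m)
      vertex v≤j = fromℕ< (s≤s (ℕ.≤-trans v≤j j≤m))

      vertex-< : ∀ {v w} (v≤j : v ≤ j) (w≤j : w ≤ j) → v < w → vertex v≤j Fin.< vertex w≤j
      vertex-< v≤j w≤j = subst₂ _<_ (sym (Fin.toℕ-fromℕ< _)) (sym (Fin.toℕ-fromℕ< _))

      k≤j = ℕ.<⇒≤ k<j
      i≤j = ℕ.<⇒≤ (ℕ.<-trans i<k k<j)

      ij ik kj : Edge (suc m)
      ij = edge (vertex i≤j) (vertex ℕ.≤-refl) (vertex-< i≤j ℕ.≤-refl (ℕ.<-trans i<k k<j))
      ik = edge (vertex i≤j) (vertex k≤j) (vertex-< i≤j k≤j i<k)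
      kj = edge (vertex k≤j) (vertex ℕ.≤-refl) (vertex-< k≤j ℕ.≤-refl k<j)

      at-i : toℕ (vertex i≤j) ≡ i
      at-i = Fin.toℕ-fromℕ< _

      at-k : toℕ (vertex k≤j) ≡ k
      at-k = Fin.toℕ-fromℕ< _

      at-j : toℕ (vertex ℕ.≤-refl) ≡ j
      at-j = Fin.toℕ-fromℕ< _

-- Aligning two lists along a relation

module _ {A B : Set} (_~_ : A → B → Set)
         (functional : ∀ {x y y′} → x ~ y → x ~ y′ → y ≡ y′) where

  -- The partner of the head of `xs` is removed from `ys`, and the rest is matched recursively.
  -- Distinctness in `xs` means having no common partner, which suits partitions known only up to
  -- `∼`.
  matching : ∀ {xs ys} → AllPairs (λ x x′ → ∀ {y} → x ~ y → ¬ x′ ~ y) xs → Unique ys →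
             (∀ {x} → x ∈ xs → ∃ λ y → y ∈ ys × x ~ y) →
             (∀ {y} → y ∈ ys → ∃ λ x → x ∈ xs × x ~ y) →
             ∃ λ zs → Pointwise _~_ xs zs × zs ↭ ys
  matching {[]} {[]}     _ _ _ _ = [] , [] , ↭-refl
  matching {[]} {y ∷ ys} _ _ _ bwd with bwd (here refl)
  ... | _ , () , _
  matching {x ∷ xs} {ys} (x# ∷ xs#) ys! fwd bwd with fwd (here refl)
  ... | y , y∈ , x~y with ∈-∃++ y∈
  ... | as , bs , refl with PermSetoid.Unique-resp-↭ (setoid B) (↭⇒↭ₛ (Perm.shift y as bs)) ys!
  ... | y∉ ∷ rest! =
    let zs , xs~zs , zs↭ = matching xs# rest! fwd′ bwd′
    in y ∷ zs , x~y ∷ xs~zs , ↭-trans (↭-prep y zs↭) (↭-sym (Perm.shift y as bs))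
    where
    fwd′ : ∀ {x′} → x′ ∈ xs → ∃ λ y′ → y′ ∈ as ++ bs × x′ ~ y′
    fwd′ x′∈ with fwd (there x′∈)
    ... | y′ , y′∈ , x′~y′ with Perm.∈-resp-↭ (Perm.shift y as bs) y′∈
    ...   | here refl = contradiction x′~y′ (All.lookup x# x′∈ x~y)
    ...   | there y′∈ = y′ , y′∈ , x′~y′

    bwd′ : ∀ {y′} → y′ ∈ as ++ bs → ∃ λ x′ → x′ ∈ xs × x′ ~ y′
    bwd′ y′∈ with bwd (Perm.∈-resp-↭ (↭-sym (Perm.shift y as bs)) (there y′∈))
    ... | _  , here refl , x~y′  = contradiction (functional x~y x~y′) (All.lookup y∉ y′∈)
    ... | x′ , there x′∈ , x′~y′ = x′ , x′∈ , x′~y′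

-- Enumeration of the trees

-- Right subtrees come first: their size becomes the index k of the recurrence for `qCatalan`, with
-- k + 1 counting their leaves.
nodes : List Tree → List Tree → List Tree
nodes = cartesianProductWith (λ r l → node l r)

-- The trees of size m, provided m ≤ b; the bound b makes the recursion structural.
trees : ℕ → ℕ → List Tree
trees _       zero    = leaf ∷ []
trees zero    (suc m) = []
trees (suc b) (suc m) = concat (tabulate {n = suc m} λ k →
  nodes (trees b (toℕ k)) (trees b (m ∸ toℕ k)))

∈-trees⁺ : ∀ b t → size t ≤ b → t ∈ trees b (size t)
∈-trees⁺ zero    leaf       _         = here refl
∈-trees⁺ (suc b) leaf       _         = here refl
∈-trees⁺ (suc b) (node l r) (s≤s l+r≤b) =
  ∈-concat⁺′ (∈-cartesianProductWith⁺ (λ r l → node l r)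
               (subst (λ k → r ∈ trees b k) (sym k≡r) (∈-trees⁺ b r (ℕ.≤-trans (ℕ.m≤n+m _ _) l+r≤b)))
               (subst (λ k → l ∈ trees b k)
                      (sym (trans (cong (size l + size r ∸_) k≡r) (ℕ.m+n∸n≡m (size l) (size r))))
                      (∈-trees⁺ b l (ℕ.≤-trans (ℕ.m≤m+n _ _) l+r≤b))))
             (∈-tabulate⁺ {f = λ k → nodes (trees b (toℕ k)) (trees b (size l + size r ∸ toℕ k))} k)
  where
  k : Fin (suc (size l + size r))
  k = fromℕ< (s≤s (ℕ.m≤n+m (size r) (size l)))

  k≡r : toℕ k ≡ size r
  k≡r = Fin.toℕ-fromℕ< (s≤s (ℕ.m≤n+m (size r) (size l)))

∈-trees⁻ : ∀ b m {t} → t ∈ trees b m → size t ≡ m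
∈-trees⁻ zero    zero    (here refl) = refl
∈-trees⁻ (suc b) zero    (here refl) = refl
∈-trees⁻ (suc b) (suc m) {t} t∈
  with ∈-concat⁻′ (tabulate {n = suc m} λ k → nodes (trees b (toℕ k)) (trees b (m ∸ toℕ k))) t∈
... | ts , t∈ts , ts∈ with ∈-tabulate⁻ {f = λ k → nodes (trees b (toℕ k)) (trees b (m ∸ toℕ k))} ts∈
... | k , ts≡ with ∈-cartesianProductWith⁻ (λ r l → node l r) (trees b (toℕ k)) (trees b (m ∸ toℕ k))
                   (subst (t ∈_) ts≡ t∈ts)
... | r , l , r∈ , l∈ , refl = cong suc (trans
  (cong₂ _+_ (∈-trees⁻ b (m ∸ toℕ k) l∈) (∈-trees⁻ b (toℕ k) r∈))
  (ℕ.m∸n+n≡m (s≤s⁻¹ (Fin.toℕ<n k))))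

-- The lists for different k are disjoint because k is the size of the right subtree.
trees-unique : ∀ b m → Unique (trees b m)
trees-unique zero    zero    = [] ∷ []
trees-unique (suc b) zero    = [] ∷ []
trees-unique zero    (suc m) = []
trees-unique (suc b) (suc m) = Unique.concat⁺
  (All.tabulate⁺ λ k → Unique.cartesianProductWith⁺ (λ r l → node l r) (λ { refl → refl , refl })
    (trees-unique b (toℕ k)) (trees-unique b (m ∸ toℕ k)))
  (AllPairs.tabulate⁺ λ {k} {k′} k≢k′ (t∈ , t∈′) → k≢k′ (Fin.toℕ-injective (sizes-agree k k′ t∈ t∈′)))
  where
  sizes-agree : ∀ (k k′ : Fin (suc m)) {t} →
    t ∈ nodes (trees b (toℕ k)) (trees b (m ∸ toℕ k)) →
    t ∈ nodes (trees b (toℕ k′)) (trees b (m ∸ toℕ k′)) →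
    toℕ k ≡ toℕ k′
  sizes-agree k k′ t∈ t∈′
    with ∈-cartesianProductWith⁻ (λ r l → node l r) (trees b (toℕ k)) (trees b (m ∸ toℕ k)) t∈
       | ∈-cartesianProductWith⁻ (λ r l → node l r) (trees b (toℕ k′)) (trees b (m ∸ toℕ k′)) t∈′
  ... | r , l , r∈ , _ , refl | _ , _ , r∈′ , _ , refl =
    trans (sym (∈-trees⁻ b (toℕ k) r∈)) (∈-trees⁻ b (toℕ k′) r∈′)

-- Weighted sums over trees

suc-C-2 : ∀ n → suc n C 2 ≡ n + n C 2
suc-C-2 n = trans (sym (nCk+nC[k+1]≡[n+1]C[k+1] n 1)) (cong (_+ n C 2) (nC1≡n n))

-- A pair among m + n objects lies in the first part, in the second, or across.
+-C-2 : ∀ m n → (m + n) C 2 ≡ m C 2 + n C 2 + m ℕ.* n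
+-C-2 zero    n = sym (ℕ.+-identityʳ _)
+-C-2 (suc m) n = begin
  suc (m + n) C 2                       ≡⟨ suc-C-2 (m + n) ⟩
  m + n + (m + n) C 2                   ≡⟨ cong (m + n +_) (+-C-2 m n) ⟩
  m + n + (m C 2 + n C 2 + m ℕ.* n)       ≡⟨ rearrange m n (m C 2) (n C 2) (m ℕ.* n) ⟩
  m + m C 2 + n C 2 + (n + m ℕ.* n)       ≡⟨ cong (λ c → c + n C 2 + (n + m ℕ.* n)) (sym (suc-C-2 m)) ⟩
  suc m C 2 + n C 2 + suc m ℕ.* n         ∎
  where
  open ≡-Reasoning
  rearrange : ∀ a b c d e → a + b + (c + d + e) ≡ a + c + d + (b + e)
  rearrange = solve-∀

module _ {c ℓ} (R : CommutativeRing c ℓ) where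

  open CommutativeRing R hiding (zero)
    renaming (_+_ to _+ᴿ_; _*_ to _*ᴿ_; refl to ≈-refl; sym to ≈-sym; trans to ≈-trans;
              setoid to ≈-setoid)
  open Algebra.Properties.Semiring.Exp semiring using (_^_; ^-homo-*; ^-congʳ; ^-congˡ)
  open Exp commutativeSemiring using (^-distrib-*)
  open Sum semiring using (sum-syntax; sum-cong-≋; *-distribˡ-sum)
  open import Relation.Binary.Reasoning.Setoid ≈-setoid
  open CommutativeMonoidSolver *-commutativeMonoid using (solve; _⊕_; _⊜_)

  sumOver-↭ : ∀ {A : Set} (f : A → Carrier) {xs ys} → xs ↭ ys → sumOver R xs f ≈ sumOver R ys f
  sumOver-↭ f _↭_.refl       = ≈-refl
  sumOver-↭ f (_↭_.prep x p)   = +-congˡ (sumOver-↭ f p)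
  sumOver-↭ f (_↭_.swap {xs} {ys} x y p) = begin
    f x +ᴿ (f y +ᴿ sumOver R xs f) ≈⟨ +-congˡ (+-congˡ (sumOver-↭ f p)) ⟩
    f x +ᴿ (f y +ᴿ sumOver R ys f) ≈⟨ +-assoc _ _ _ ⟨
    f x +ᴿ f y +ᴿ sumOver R ys f   ≈⟨ +-congʳ (+-comm _ _) ⟩
    f y +ᴿ f x +ᴿ sumOver R ys f   ≈⟨ +-assoc _ _ _ ⟩
    f y +ᴿ (f x +ᴿ sumOver R ys f) ∎
  sumOver-↭ f (_↭_.trans p p′) = ≈-trans (sumOver-↭ f p) (sumOver-↭ f p′)

  sumOver-Pointwise : ∀ {A B : Set} {_~_ : A → B → Set} {f : A → Carrier} {g : B → Carrier} →
    (∀ {x y} → x ~ y → f x ≈ g y) →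
    ∀ {xs ys} → Pointwise _~_ xs ys → sumOver R xs f ≈ sumOver R ys g
  sumOver-Pointwise f≈g []            = ≈-refl
  sumOver-Pointwise f≈g (x~y ∷ xs~ys) = +-cong (f≈g x~y) (sumOver-Pointwise f≈g xs~ys)

  sumOver-++ : ∀ {A : Set} (f : A → Carrier) xs ys →
               sumOver R (xs ++ ys) f ≈ sumOver R xs f +ᴿ sumOver R ys f
  sumOver-++ f []       ys = ≈-sym (+-identityˡ _)
  sumOver-++ f (x ∷ xs) ys = ≈-trans (+-congˡ (sumOver-++ f xs ys)) (≈-sym (+-assoc _ _ _))

  sumOver-concat-tabulate : ∀ {A : Set} (f : A → Carrier) {n} (g : Fin n → List A) →
    sumOver R (concat (tabulate g)) f ≈ ∑[ k < n ] sumOver R (g k) f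
  sumOver-concat-tabulate f {zero}  g = ≈-refl
  sumOver-concat-tabulate f {suc n} g = ≈-trans (sumOver-++ f (g zero) _)
    (+-congˡ (sumOver-concat-tabulate f (g ∘ suc)))

  -- The membership premise lets the constant `a` depend on a property common to the entries of
  -- `xs`, here the size of the right subtrees.
  sumOver-cartesianProductWith : ∀ {A B D : Set} (_⊗_ : A → B → D) {f : D → Carrier}
    a (g : A → Carrier) (h : B → Carrier) xs ys →
    (∀ {x y} → x ∈ xs → f (x ⊗ y) ≈ a *ᴿ (g x *ᴿ h y)) →
    sumOver R (cartesianProductWith _⊗_ xs ys) f ≈ a *ᴿ (sumOver R xs g *ᴿ sumOver R ys h)
  sumOver-cartesianProductWith _⊗_ a g h [] ys f≈ =
    ≈-sym (≈-trans (*-congˡ (zeroˡ _)) (zeroʳ a))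
  sumOver-cartesianProductWith _⊗_ {f} a g h (x ∷ xs) ys f≈ = begin
    sumOver R (map (x ⊗_) ys ++ cartesianProductWith _⊗_ xs ys) f
      ≈⟨ sumOver-++ f (map (x ⊗_) ys) _ ⟩
    sumOver R (map (x ⊗_) ys) f +ᴿ sumOver R (cartesianProductWith _⊗_ xs ys) f
      ≈⟨ +-cong (row ys) (sumOver-cartesianProductWith _⊗_ a g h xs ys (f≈ ∘ there)) ⟩
    a *ᴿ (g x *ᴿ sumOver R ys h) +ᴿ a *ᴿ (sumOver R xs g *ᴿ sumOver R ys h)
      ≈⟨ distribˡ a _ _ ⟨
    a *ᴿ (g x *ᴿ sumOver R ys h +ᴿ sumOver R xs g *ᴿ sumOver R ys h)
      ≈⟨ *-congˡ (distribʳ _ _ _) ⟨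
    a *ᴿ ((g x +ᴿ sumOver R xs g) *ᴿ sumOver R ys h) ∎
    where
    row : ∀ ys → sumOver R (map (x ⊗_) ys) f ≈ a *ᴿ (g x *ᴿ sumOver R ys h)
    row []       = ≈-sym (≈-trans (*-congˡ (zeroʳ _)) (zeroʳ a))
    row (y ∷ ys) = begin
      f (x ⊗ y) +ᴿ sumOver R (map (x ⊗_) ys) f               ≈⟨ +-cong (f≈ (here refl)) (row ys) ⟩
      a *ᴿ (g x *ᴿ h y) +ᴿ a *ᴿ (g x *ᴿ sumOver R ys h)      ≈⟨ distribˡ a _ _ ⟨
      a *ᴿ (g x *ᴿ h y +ᴿ g x *ᴿ sumOver R ys h)             ≈⟨ *-congˡ (distribˡ _ _ _) ⟨
      a *ᴿ (g x *ᴿ (h y +ᴿ sumOver R ys h))                  ∎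

  module _ (q q⁻¹ : Carrier) (q*q⁻¹≈1 : q *ᴿ q⁻¹ ≈ 1#) where

    1^n≈1 : ∀ n → 1# ^ n ≈ 1#
    1^n≈1 zero    = ≈-refl
    1^n≈1 (suc n) = ≈-trans (*-identityˡ _) (1^n≈1 n)

    ^-cancel : ∀ m n → q ^ (m + n) *ᴿ q⁻¹ ^ n ≈ q ^ m
    ^-cancel m n = begin
      q ^ (m + n) *ᴿ q⁻¹ ^ n       ≈⟨ *-congʳ (^-homo-* q m n) ⟩
      q ^ m *ᴿ q ^ n *ᴿ q⁻¹ ^ n    ≈⟨ *-assoc _ _ _ ⟩
      q ^ m *ᴿ (q ^ n *ᴿ q⁻¹ ^ n)  ≈⟨ *-congˡ (^-distrib-* q q⁻¹ n) ⟨
      q ^ m *ᴿ (q *ᴿ q⁻¹) ^ n      ≈⟨ *-congˡ (^-congˡ n q*q⁻¹≈1) ⟩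
      q ^ m *ᴿ 1# ^ n              ≈⟨ *-congˡ (1^n≈1 n) ⟩
      q ^ m *ᴿ 1#                  ≈⟨ *-identityʳ _ ⟩
      q ^ m                        ∎

    -- Between k + 1 right and j + 1 left leaves there are (k + 1)(j + 1) mixed pairs: k + 1 of them
    -- are the contribution of the root, and the power of `q⁻¹` cancels the remaining (k + 1) j.
    ^-C-2 : ∀ k j → q ^ suc k *ᴿ (q ^ (suc k C 2) *ᴿ q ^ (suc j C 2)) ≈
                    q ^ (suc (suc (k + j)) C 2) *ᴿ q⁻¹ ^ (suc k ℕ.* j)
    ^-C-2 k j = begin
      q ^ suc k *ᴿ (q ^ (suc k C 2) *ᴿ q ^ (suc j C 2))
        ≈⟨ *-congˡ (^-homo-* q (suc k C 2) (suc j C 2)) ⟨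
      q ^ suc k *ᴿ q ^ (suc k C 2 + suc j C 2)
        ≈⟨ ^-homo-* q (suc k) (suc k C 2 + suc j C 2) ⟨
      q ^ (suc k + (suc k C 2 + suc j C 2))
        ≈⟨ ^-cancel (suc k + (suc k C 2 + suc j C 2)) (suc k ℕ.* j) ⟨
      q ^ (suc k + (suc k C 2 + suc j C 2) + suc k ℕ.* j) *ᴿ q⁻¹ ^ (suc k ℕ.* j)
        ≈⟨ *-congʳ (^-congʳ q exponent) ⟩
      q ^ (suc (suc (k + j)) C 2) *ᴿ q⁻¹ ^ (suc k ℕ.* j) ∎
      where
      rearrange : ∀ a b c j → a + (b + c) + a ℕ.* j ≡ b + c + a ℕ.* suc j
      rearrange = solve-∀

      exponent : suc k + (suc k C 2 + suc j C 2) + suc k ℕ.* j ≡ suc (suc (k + j)) C 2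
      exponent = trans (rearrange (suc k) (suc k C 2) (suc j C 2) j)
        (trans (sym (+-C-2 (suc k) (suc j))) (cong (λ n → suc n C 2) (ℕ.+-suc k j)))

    -- Right subtrees of size k and left subtrees of size m - k supply the two Catalan factors of
    -- the term k; `^-C-2` accounts for the powers of q.
    sumOver-trees : ∀ b m → m ≤ b →
      sumOver R (trees b m) (λ t → q ^ weight t) ≈ q ^ (suc m C 2) *ᴿ qCatalan R q⁻¹ m
    sumOver-trees zero    zero    _ = ≈-trans (+-identityʳ _) (≈-sym (*-identityʳ _))
    sumOver-trees (suc b) zero    _ = ≈-trans (+-identityʳ _) (≈-sym (*-identityʳ _))
    sumOver-trees (suc b) (suc m) (s≤s m≤b) = begin
      sumOver R (trees (suc b) (suc m)) (λ t → q ^ weight t)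
        ≈⟨ sumOver-concat-tabulate (λ t → q ^ weight t) {suc m} products ⟩
      ∑[ k < suc m ] sumOver R (products k) (λ t → q ^ weight t)
        ≈⟨ sum-cong-≋ {suc m} summand ⟩
      ∑[ k < suc m ] (Q *ᴿ term k)
        ≈⟨ *-distribˡ-sum {suc m} Q term ⟨
      Q *ᴿ (∑[ k < suc m ] term k)
        ≈⟨ *-congˡ (qCatalan-suc R q⁻¹ m) ⟨
      Q *ᴿ qCatalan R q⁻¹ (suc m) ∎
      where
      Q = q ^ (suc (suc m) C 2)

      Cat : ℕ → Carrier
      Cat = qCatalan R q⁻¹

      products : Fin (suc m) → List Tree
      products k = nodes (trees b (toℕ k)) (trees b (m ∸ toℕ k))

      term : Fin (suc m) → Carrier
      term k = q⁻¹ ^ (suc (toℕ k) ℕ.* (m ∸ toℕ k)) *ᴿ Cat (toℕ k) *ᴿ Cat (m ∸ toℕ k)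

      ^-weight : ∀ {k r l} → size r ≡ k →
                 q ^ weight (node l r) ≈ q ^ suc k *ᴿ (q ^ weight r *ᴿ q ^ weight l)
      ^-weight {r = r} {l} refl = ≈-trans (^-homo-* q (suc (size r)) (weight l + weight r))
        (*-congˡ (≈-trans (^-homo-* q (weight l) (weight r)) (*-comm _ _)))

      summand : ∀ k → sumOver R (products k) (λ t → q ^ weight t) ≈ Q *ᴿ term k
      summand k̂ = begin
        sumOver R (products k̂) (λ t → q ^ weight t)
          ≈⟨ sumOver-cartesianProductWith (λ r l → node l r) (q ^ suc k) _ _ (trees b k) (trees b j)
               (λ {r} {l} r∈ → ^-weight {l = l} (∈-trees⁻ b k r∈)) ⟩
        q ^ suc k *ᴿ (sumOver R (trees b k) (λ t → q ^ weight t) *ᴿ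
                      sumOver R (trees b j) (λ t → q ^ weight t))
          ≈⟨ *-congˡ (*-cong (sumOver-trees b k (ℕ.≤-trans k≤m m≤b))
                             (sumOver-trees b j (ℕ.≤-trans (ℕ.m∸n≤m m k) m≤b))) ⟩
        q ^ suc k *ᴿ (q ^ (suc k C 2) *ᴿ Cat k *ᴿ (q ^ (suc j C 2) *ᴿ Cat j))
          ≈⟨ solve 5 (λ a x u y v → (a ⊕ ((x ⊕ u) ⊕ (y ⊕ v))) ⊜ ((a ⊕ (x ⊕ y)) ⊕ (u ⊕ v)))
                   ≈-refl _ _ _ _ _ ⟩
        q ^ suc k *ᴿ (q ^ (suc k C 2) *ᴿ q ^ (suc j C 2)) *ᴿ (Cat k *ᴿ Cat j)
          ≈⟨ *-congʳ (^-C-2 k j) ⟩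
        q ^ (suc (suc (k + j)) C 2) *ᴿ q⁻¹ ^ (suc k ℕ.* j) *ᴿ (Cat k *ᴿ Cat j)
          ≈⟨ *-congʳ (*-congʳ (^-congʳ q (cong (λ n → suc (suc n) C 2) (ℕ.m+[n∸m]≡n k≤m)))) ⟩
        Q *ᴿ q⁻¹ ^ (suc k ℕ.* j) *ᴿ (Cat k *ᴿ Cat j)
          ≈⟨ solve 4 (λ a x u v → ((a ⊕ x) ⊕ (u ⊕ v)) ⊜ (a ⊕ ((x ⊕ u) ⊕ v))) ≈-refl _ _ _ _ ⟩
        Q *ᴿ term k̂ ∎
        where
        k = toℕ k̂
        j = m ∸ k
        k≤m = s≤s⁻¹ (Fin.toℕ<n k̂)

-- Matching partitions with trees

Presentation : ∀ m → Labelling (suc m) m → Tree → Set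
Presentation m p t = size t ≡ m × p presents t

presentation-unique : ∀ m p {t t′} → Presentation m p t → Presentation m p t′ → t ≡ t′
presentation-unique _ p {t} {t′} (refl , pres) (size≡ , pres′) =
  presents-unique t t′ p size≡ pres pres′

-- Partitions presented by one tree are `∼`, so `T` lists at most one for each tree;
-- `tree-presenting` and `label` supply the two directions of the correspondence.
T-matches-trees : ∀ m → ∃ λ ts → Pointwise (Presentation m) (T (suc m) m) ts × ts ↭ trees m m
T-matches-trees m = matching (Presentation m) (λ {p} → presentation-unique m p)
  (AllPairs.map (λ {p} {p′} p≁p′ {t} (_ , pres) (_ , pres′) → p≁p′ (same-tree p p′ {t} pres pres′))
                (T-unique (suc m) m))
  (trees-unique m m)
  (λ {p} p∈ → let t , size≡ , pres = tree-presenting p (T-sound p∈) in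
    t , subst (λ k → t ∈ trees m k) size≡ (∈-trees⁺ m t (ℕ.≤-reflexive size≡)) , size≡ , pres)
  (λ t∈ → labelled _ (∈-trees⁻ m m t∈))
  where
  same-tree : ∀ (p p′ : Labelling (suc m) m) {t} → p presents t → p′ presents t → p ∼ p′
  same-tree p p′ pres pres′ e f = mk⇔
    (Equivalence.from (pres′ e f) ∘ Equivalence.to (pres e f))
    (Equivalence.from (pres e f) ∘ Equivalence.to (pres′ e f))

  labelled : ∀ {m} t → size t ≡ m → ∃ λ p → p ∈ T (suc m) m × Presentation m p t
  labelled t refl with find (T-complete (label t) (label-isTransitivePartition t))
  -- `T` contains `label t` only up to `∼`, and being presented by `t` is invariant under `∼`.
  ... | p , p∈ , label∼p = p , p∈ , refl , λ e f → mk⇔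
    (Equivalence.to (label-presents t e f) ∘ Equivalence.from (label∼p e f))
    (Equivalence.to (label∼p e f) ∘ Equivalence.from (label-presents t e f))

proposition3p22 : ∀ {c ℓ} (R : CommutativeRing c ℓ) →
    let open CommutativeRing R
        open Algebra.Properties.Semiring.Exp semiring using (_^_) in
    (q q⁻¹ : Carrier) → q * q⁻¹ ≈ 1# →
    (n : ℕ) → n > 1 →
    sumOver R (T n (n ∸ 1)) (λ p → q ^ minimal p)
      ≈ q ^ (n C 2) * qCatalan R q⁻¹ (n ∸ 1)
proposition3p22 R q q⁻¹ q*q⁻¹≈1 (suc m) _ =
  let ts , T~ts , ts↭ = T-matches-trees m in
  ≈-trans (sumOver-Pointwise R (minimal≈ _ _) T~ts)
 (≈-trans (sumOver-↭ R (λ t → q ^ weight t) ts↭)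
          (sumOver-trees R q q⁻¹ q*q⁻¹≈1 m m ℕ.≤-refl))
  where
  open CommutativeRing R using (_≈_; semiring) renaming (trans to ≈-trans)
  open Algebra.Properties.Semiring.Exp semiring using (_^_; ^-congʳ)

  minimal≈ : ∀ {m} (p : Labelling (suc m) m) t → Presentation m p t → q ^ minimal p ≈ q ^ weight t
  minimal≈ p t (refl , pres) = ^-congʳ q (minimal-presents t p pres)
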